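{- For every constant $c>0$ there exist $c'>0$ and $n_0$ such that for every $n \ge n_0$, every graph $G$ on $n$ vertices with minimum degree $\delta(G) \ge n/2 + c\sqrt{n}$ satisfies $\operatorname{Cyc}(G) \ge c' 2^n$.
   Context: All graphs are finite and simple. For a graph $G$, a subset $S \subseteq V(G)$ is cyclic if there is a cycle in $G$ whose vertex set is precisely $S$, i.e. the induced subgraph $G[S]$ is Hamiltonian (cycles have at least 3 vertices). $\operatorname{Cyc}(G)$ denotes the number of cyclic subsets of $V(G)$. -}

module Defs where

open import Data.Empty using (⊥)
open import Data.Fin.Base using (Fin; zero; suc)
import Data.Fin.Properties as Fin
open import Data.Fin.Subset using (Subset; inside; outside; _∈_; ∣_∣)
open import Data.Fin.Subset.Properties using (_∈?_)
open import Data.Integer.Base as ℤ using (+_)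
import Data.Integer.Properties as ℤ
open import Data.List.Base
  using (List; []; _∷_; _∷ʳ_; _++_; map; filter; length; allFin; lookup)
open import Data.List.Extrema.Nat using (min)
import Data.List.Membership.DecPropositional as DecMembership
open import Data.List.Membership.Propositional using () renaming (_∈_ to _∈ₗ_)
open import Data.List.Membership.Propositional.Properties using (∈-lookup)
import Data.List.Relation.Unary.All as All
open import Data.List.Relation.Unary.AllPairs using (_∷_)
open import Data.List.Relation.Unary.Linked using (Linked; linked?)
open import Data.List.Relation.Unary.Unique.Propositional using (Unique)
import Data.List.Relation.Unary.Unique.DecPropositional as DecUnique
open import Data.Nat.Base as ℕ using (ℕ; zero; suc; z≤n; s≤s; _⊔_)
import Data.Nat.Properties as ℕ
open import Data.Nat.Solver using (module +-*-Solver)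
open import Data.Product.Base using (∃; _×_; _,_; proj₁)
open import Data.Rational.Base as ℚ using (ℚ; 0ℚ; 1ℚ; _/_)
import Data.Rational.Properties as ℚ
import Data.Rational.Solver as ℚSolver
open import Data.Rational.Unnormalised.Base as ℚᵘ using (mkℚᵘ)
import Data.Rational.Unnormalised.Properties as ℚᵘ
open import Data.Sum.Base using (inj₁; inj₂)
open import Data.Vec.Base using ([]; _∷_; tabulate)
open import Function.Bundles using (_⇔_; mk⇔; Equivalence)
open import Level using (0ℓ)
open import Relation.Binary.Definitions using (Symmetric; Irreflexive)
  renaming (Decidable to Decidable₂)
open import Relation.Binary.PropositionalEquality
  using (_≡_; refl; sym; trans; cong; cong₂; subst)
open import Relation.Nullary using (Dec; yes; no; does; contradiction)
open import Relation.Nullary.Decidable using (map′; _×-dec_; _→-dec_)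
open import Relation.Unary using (Pred; Decidable)

IsCauchy : (ℕ → ℚ) → Set
IsCauchy x = ∀ ε → 0ℚ ℚ.< ε →
  ∃ λ N → ∀ i j → N ℕ.≤ i → N ℕ.≤ j → ℚ.∣ x i ℚ.- x j ∣ ℚ.≤ ε

-- A real number is a Cauchy sequence of rationals.  Equal reals may be
-- given by different sequences; _≤_ and _<_ below do not depend on the
-- choice.
record ℝ : Set where
  constructor mkℝ
  field
    seq    : ℕ → ℚ
    cauchy : IsCauchy seq

open ℝ public

module Lemmas where

  open import Data.Rational.Base using (_+_; _-_; _*_; -_; _≤_; _<_)

  *-mono : ∀ {a b c d} → 0ℚ ≤ b → 0ℚ ≤ c → a ≤ c → b ≤ d → a * b ≤ c * d
  *-mono {a} {b} {c} {d} 0≤b 0≤c a≤c b≤d = ℚ.≤-trans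
    (ℚ.*-monoʳ-≤-nonNeg b {{ℚ.nonNegative 0≤b}} a≤c)
    (ℚ.*-monoˡ-≤-nonNeg c {{ℚ.nonNegative 0≤c}} b≤d)

  half+half : ∀ ε → ε * ℚ.½ + ε * ℚ.½ ≡ ε
  half+half ε = trans (sym (ℚ.*-distribˡ-+ ε ℚ.½ ℚ.½)) (ℚ.*-identityʳ ε)

  half-pos : ∀ {ε} → 0ℚ < ε → 0ℚ < ε * ℚ.½
  half-pos {ε} 0<ε = ℚ.positive⁻¹ (ε * ℚ.½)
    {{ℚ.pos*pos⇒pos ε {{ℚ.positive 0<ε}} ℚ.½}}

  const-cauchy : ∀ p → IsCauchy (λ _ → p)
  const-cauchy p ε 0<ε = 0 , λ i j _ _ → subst (_≤ ε)
    (sym (cong ℚ.∣_∣ (ℚ.+-inverseʳ p))) (ℚ.<⇒≤ 0<ε)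

  module _ {x y : ℕ → ℚ} (cx : IsCauchy x) (cy : IsCauchy y) where

    +-cauchy : IsCauchy (λ i → x i + y i)
    +-cauchy ε 0<ε with cx (ε * ℚ.½) (half-pos 0<ε) | cy (ε * ℚ.½) (half-pos 0<ε)
    ... | M , hx | N , hy = M ⊔ N , λ i j le le′ → begin
      ℚ.∣ (x i + y i) - (x j + y j) ∣
        ≡⟨ cong ℚ.∣_∣ (rearrange (x i) (y i) (x j) (y j)) ⟩
      ℚ.∣ (x i - x j) + (y i - y j) ∣
        ≤⟨ ℚ.∣p+q∣≤∣p∣+∣q∣ (x i - x j) (y i - y j) ⟩
      ℚ.∣ x i - x j ∣ + ℚ.∣ y i - y j ∣
        ≤⟨ ℚ.+-mono-≤ (hx i j (ℕ.m⊔n≤o⇒m≤o M N le) (ℕ.m⊔n≤o⇒m≤o M N le′))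
                      (hy i j (ℕ.m⊔n≤o⇒n≤o M N le) (ℕ.m⊔n≤o⇒n≤o M N le′)) ⟩
      ε * ℚ.½ + ε * ℚ.½
        ≡⟨ half+half ε ⟩
      ε ∎
      where
      open ℚ.≤-Reasoning
      open ℚSolver.+-*-Solver
      rearrange : ∀ a b c d → (a + b) - (c + d) ≡ (a - c) + (b - d)
      rearrange = solve 4
        (λ a b c d → (a :+ b) :- (c :+ d) := (a :- c) :+ (b :- d)) refl

  eventually-bounded : ∀ {x} → IsCauchy x →
    ∃ λ B → 0ℚ < B × ∃ λ N → ∀ i → N ℕ.≤ i → ℚ.∣ x i ∣ ≤ B
  eventually-bounded {x} cx with cx 1ℚ (ℚ.positive⁻¹ 1ℚ)
  ... | N , h = 1ℚ + ℚ.∣ x N ∣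
              , ℚ.positive⁻¹ _
                  {{ℚ.pos+nonNeg⇒pos 1ℚ ℚ.∣ x N ∣ {{ℚ.∣-∣-nonNeg (x N)}}}}
              , N , λ i le → begin
    ℚ.∣ x i ∣                       ≡⟨ cong ℚ.∣_∣ (split (x i) (x N)) ⟩
    ℚ.∣ (x i - x N) + x N ∣         ≤⟨ ℚ.∣p+q∣≤∣p∣+∣q∣ (x i - x N) (x N) ⟩
    ℚ.∣ x i - x N ∣ + ℚ.∣ x N ∣     ≤⟨ ℚ.+-monoˡ-≤ ℚ.∣ x N ∣ (h i N le ℕ.≤-refl) ⟩
    1ℚ + ℚ.∣ x N ∣                  ∎
    where
    open ℚ.≤-Reasoning
    open ℚSolver.+-*-Solver
    split : ∀ a b → a ≡ (a - b) + b
    split = solve 2 (λ a b → a := (a :- b) :+ b) refl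

  module _ (B C : ℚ) (0<B : 0ℚ < B) (0<C : 0ℚ < C) where

    split-ε : ∀ ε → 0ℚ < ε → ∃ λ δ → 0ℚ < δ × B * δ + δ * C ≡ ε
    split-ε ε 0<ε = ε * K⁻¹
      , ℚ.positive⁻¹ (ε * K⁻¹)
          {{ℚ.pos*pos⇒pos ε {{ℚ.positive 0<ε}} K⁻¹ {{ℚ.1/pos⇒pos (B + C)}}}}
      , trans (rearrange B C ε K⁻¹)
          (trans (cong (ε *_) (ℚ.*-inverseʳ (B + C))) (ℚ.*-identityʳ ε))
      where
      open ℚSolver.+-*-Solver
      instance
        K-pos : ℚ.Positive (B + C)
        K-pos = ℚ.pos+pos⇒pos B {{ℚ.positive 0<B}} C {{ℚ.positive 0<C}}
        K-nonZero : ℚ.NonZero (B + C)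
        K-nonZero = ℚ.pos⇒nonZero (B + C)
      K⁻¹ : ℚ
      K⁻¹ = ℚ.1/ (B + C)
      rearrange : ∀ b c e k → b * (e * k) + (e * k) * c ≡ e * ((b + c) * k)
      rearrange = solve 4 (λ b c e k →
        b :* (e :* k) :+ (e :* k) :* c := e :* ((b :+ c) :* k)) refl

    product-close : ∀ δ → 0ℚ < δ → ∀ a b c d →
      ℚ.∣ a ∣ ≤ B → ℚ.∣ d ∣ ≤ C → ℚ.∣ a - c ∣ ≤ δ → ℚ.∣ b - d ∣ ≤ δ →
      ℚ.∣ a * b - c * d ∣ ≤ B * δ + δ * C
    product-close δ 0<δ a b c d a≤B d≤C ac bd = begin
      ℚ.∣ a * b - c * d ∣
        ≡⟨ cong ℚ.∣_∣ (rearrange a b c d) ⟩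
      ℚ.∣ a * (b - d) + (a - c) * d ∣
        ≤⟨ ℚ.∣p+q∣≤∣p∣+∣q∣ (a * (b - d)) ((a - c) * d) ⟩
      ℚ.∣ a * (b - d) ∣ + ℚ.∣ (a - c) * d ∣
        ≡⟨ cong₂ _+_ (ℚ.∣p*q∣≡∣p∣*∣q∣ a (b - d)) (ℚ.∣p*q∣≡∣p∣*∣q∣ (a - c) d) ⟩
      ℚ.∣ a ∣ * ℚ.∣ b - d ∣ + ℚ.∣ a - c ∣ * ℚ.∣ d ∣
        ≤⟨ ℚ.+-mono-≤ (*-mono (ℚ.0≤∣p∣ (b - d)) (ℚ.<⇒≤ 0<B) a≤B bd)
                      (*-mono (ℚ.0≤∣p∣ d) (ℚ.<⇒≤ 0<δ) ac d≤C) ⟩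
      B * δ + δ * C ∎
      where
      open ℚ.≤-Reasoning
      open ℚSolver.+-*-Solver
      rearrange : ∀ a b c d → a * b - c * d ≡ a * (b - d) + (a - c) * d
      rearrange = solve 4 (λ a b c d →
        a :* b :- c :* d := a :* (b :- d) :+ (a :- c) :* d) refl

  *-cauchy : ∀ {x y} → IsCauchy x → IsCauchy y → IsCauchy (λ i → x i * y i)
  *-cauchy {x} {y} cx cy ε 0<ε =
    let B , 0<B , M , hB = eventually-bounded cx
        C , 0<C , N , hC = eventually-bounded cy
        δ , 0<δ , eq     = split-ε B C 0<B 0<C ε 0<ε
        P , hx           = cx δ 0<δ
        Q , hy           = cy δ 0<δ
        M≤ : ∀ {i} → (M ⊔ N) ⊔ (P ⊔ Q) ℕ.≤ i → M ℕ.≤ i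
        M≤ le = ℕ.m⊔n≤o⇒m≤o M N (ℕ.m⊔n≤o⇒m≤o (M ⊔ N) (P ⊔ Q) le)
        N≤ : ∀ {i} → (M ⊔ N) ⊔ (P ⊔ Q) ℕ.≤ i → N ℕ.≤ i
        N≤ le = ℕ.m⊔n≤o⇒n≤o M N (ℕ.m⊔n≤o⇒m≤o (M ⊔ N) (P ⊔ Q) le)
        P≤ : ∀ {i} → (M ⊔ N) ⊔ (P ⊔ Q) ℕ.≤ i → P ℕ.≤ i
        P≤ le = ℕ.m⊔n≤o⇒m≤o P Q (ℕ.m⊔n≤o⇒n≤o (M ⊔ N) (P ⊔ Q) le)
        Q≤ : ∀ {i} → (M ⊔ N) ⊔ (P ⊔ Q) ℕ.≤ i → Q ℕ.≤ i
        Q≤ le = ℕ.m⊔n≤o⇒n≤o P Q (ℕ.m⊔n≤o⇒n≤o (M ⊔ N) (P ⊔ Q) le)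
    in (M ⊔ N) ⊔ (P ⊔ Q) , λ i j i≥ j≥ →
      ℚ.≤-trans
        (product-close B C 0<B 0<C δ 0<δ (x i) (y i) (x j) (y j)
          (hB i (M≤ i≥)) (hC j (N≤ j≥))
          (hx i j (P≤ i≥) (P≤ j≥)) (hy i j (Q≤ i≥) (Q≤ j≥)))
        (ℚ.≤-reflexive eq)

fromℚ : ℚ → ℝ
fromℚ p = mkℝ (λ _ → p) (Lemmas.const-cauchy p)

fromℕ : ℕ → ℝ
fromℕ n = fromℚ (+ n / 1)

0ℝ : ℝ
0ℝ = fromℚ 0ℚ

infixl 6 _+_
infixl 7 _*_
infix  4 _≤_ _<_

_+_ : ℝ → ℝ → ℝ
x + y = mkℝ (λ i → seq x i ℚ.+ seq y i)
  (Lemmas.+-cauchy {seq x} {seq y} (cauchy x) (cauchy y))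

_*_ : ℝ → ℝ → ℝ
x * y = mkℝ (λ i → seq x i ℚ.* seq y i)
  (Lemmas.*-cauchy {seq x} {seq y} (cauchy x) (cauchy y))

_≤_ : ℝ → ℝ → Set
x ≤ y = ∀ ε → 0ℚ ℚ.< ε →
  ∃ λ N → ∀ i → N ℕ.≤ i → seq x i ℚ.≤ seq y i ℚ.+ ε

_<_ : ℝ → ℝ → Set
x < y = ∃ λ ε → 0ℚ ℚ.< ε ×
  ∃ λ N → ∀ i → N ℕ.≤ i → seq x i ℚ.+ ε ℚ.≤ seq y i

floorSqrt : ∀ m → ∃ λ r → r ℕ.* r ℕ.≤ m × m ℕ.< suc r ℕ.* suc r
floorSqrt zero = 0 , z≤n , s≤s z≤n
floorSqrt (suc m) with floorSqrt m
... | r , r²≤m , m<r⁺² with suc r ℕ.* suc r ℕ.≤? suc m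
...   | yes r⁺²≤m⁺ = suc r , r⁺²≤m⁺ ,
          ℕ.≤-<-trans m<r⁺² (ℕ.*-mono-< (ℕ.n<1+n (suc r)) (ℕ.n<1+n (suc r)))
...   | no  r⁺²≰m⁺ = r , ℕ.m≤n⇒m≤1+n r²≤m , ℕ.≰⇒> r⁺²≰m⁺

-- The k-th approximation to √ n is ⌊ √(n (k+1)²) ⌋ / (k+1), which lies
-- in the interval (√ n - 1/(k+1) , √ n].
√-numerator : ℕ → ℕ → ℕ
√-numerator n k = proj₁ (floorSqrt (n ℕ.* (suc k ℕ.* suc k)))

√-seq : ℕ → ℕ → ℚ
√-seq n k = + √-numerator n k / suc k

module √-Lemmas where

  -- √-numerator n k / (k+1) ≤ √ n < (√-numerator n l + 1) / (l+1)
  cross : ∀ n k l →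
    √-numerator n k ℕ.* suc l ℕ.< suc (√-numerator n l) ℕ.* suc k
  cross n k l with floorSqrt (n ℕ.* (suc k ℕ.* suc k))
                 | floorSqrt (n ℕ.* (suc l ℕ.* suc l))
  ... | a , a² , _ | b , _ , b² = ℕ.≰⇒> λ le → ℕ.<-irrefl refl (begin-strict
    (suc b ℕ.* K) ℕ.* (suc b ℕ.* K)  ≤⟨ ℕ.*-mono-≤ le le ⟩
    (a ℕ.* L) ℕ.* (a ℕ.* L)          ≡⟨ sq a L ⟩
    (a ℕ.* a) ℕ.* (L ℕ.* L)          ≤⟨ ℕ.*-monoˡ-≤ (L ℕ.* L) a² ⟩
    (n ℕ.* (K ℕ.* K)) ℕ.* (L ℕ.* L)  ≡⟨ swap n (K ℕ.* K) (L ℕ.* L) ⟩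
    (n ℕ.* (L ℕ.* L)) ℕ.* (K ℕ.* K)  <⟨ ℕ.*-monoˡ-< (K ℕ.* K) b² ⟩
    (suc b ℕ.* suc b) ℕ.* (K ℕ.* K)  ≡⟨ sym (sq (suc b) K) ⟩
    (suc b ℕ.* K) ℕ.* (suc b ℕ.* K)  ∎)
    where
    open ℕ.≤-Reasoning
    open +-*-Solver
    K = suc k
    L = suc l
    sq : ∀ u v → (u ℕ.* v) ℕ.* (u ℕ.* v) ≡ (u ℕ.* u) ℕ.* (v ℕ.* v)
    sq = solve 2 (λ u v → (u :* v) :* (u :* v) := (u :* u) :* (v :* v)) refl
    swap : ∀ u v w → (u ℕ.* v) ℕ.* w ≡ (u ℕ.* w) ℕ.* v
    swap = solve 3 (λ u v w → (u :* v) :* w := (u :* w) :* v) refl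

  /-mono : ∀ a b k l → a ℕ.* suc l ℕ.≤ b ℕ.* suc k →
    (+ a / suc k) ℚ.≤ (+ b / suc l)
  /-mono a b k l le = ℚ.toℚᵘ-cancel-≤ (begin
    ℚ.toℚᵘ (+ a / suc k)  ≃⟨ ℚ.toℚᵘ-fromℚᵘ (mkℚᵘ (+ a) k) ⟩
    mkℚᵘ (+ a) k          ≤⟨ ℚᵘ.*≤* (ℤ.≤-trans (ℤ.≤-reflexive (sym (ℤ.pos-* a (suc l))))
                               (ℤ.≤-trans (ℤ.+≤+ le) (ℤ.≤-reflexive (ℤ.pos-* b (suc k))))) ⟩
    mkℚᵘ (+ b) l          ≃⟨ ℚᵘ.≃-sym (ℚ.toℚᵘ-fromℚᵘ (mkℚᵘ (+ b) l)) ⟩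
    ℚ.toℚᵘ (+ b / suc l)  ∎)
    where open ℚᵘ.≤-Reasoning

  suc-/ : ∀ b l → (+ suc b / suc l) ≡ (+ b / suc l) ℚ.+ (+ 1 / suc l)
  suc-/ b l = ℚ.toℚᵘ-injective (begin-equality
    ℚ.toℚᵘ (+ suc b / suc l)
      ≃⟨ ℚ.toℚᵘ-fromℚᵘ (mkℚᵘ (+ suc b) l) ⟩
    mkℚᵘ (+ suc b) l
      ≃⟨ ℚᵘ.*≡* eq ⟩
    mkℚᵘ (+ b) l ℚᵘ.+ mkℚᵘ (+ 1) l
      ≃⟨ ℚᵘ.≃-sym (ℚᵘ.+-cong (ℚ.toℚᵘ-fromℚᵘ (mkℚᵘ (+ b) l))
                             (ℚ.toℚᵘ-fromℚᵘ (mkℚᵘ (+ 1) l))) ⟩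
    ℚ.toℚᵘ (+ b / suc l) ℚᵘ.+ ℚ.toℚᵘ (+ 1 / suc l)
      ≃⟨ ℚᵘ.≃-sym (ℚ.toℚᵘ-homo-+ (+ b / suc l) (+ 1 / suc l)) ⟩
    ℚ.toℚᵘ ((+ b / suc l) ℚ.+ (+ 1 / suc l)) ∎)
    where
    open ℚᵘ.≤-Reasoning
    L = + suc l
    eq : (+ suc b) ℤ.* (L ℤ.* L) ≡ (+ b ℤ.* L ℤ.+ + 1 ℤ.* L) ℤ.* L
    eq = trans (sym (ℤ.*-assoc (+ suc b) L L)) (cong (ℤ._* L)
      (trans (cong (ℤ._* L) (cong +_ (ℕ.+-comm 1 b))) (ℤ.*-distribʳ-+ L (+ b) (+ 1))))

  close : ∀ n k l → √-seq n k ℚ.≤ √-seq n l ℚ.+ (+ 1 / suc l)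
  close n k l = ℚ.≤-trans
    (/-mono (√-numerator n k) (suc (√-numerator n l)) k l (ℕ.<⇒≤ (cross n k l)))
    (ℚ.≤-reflexive (suc-/ (√-numerator n l) l))

  archimedean : ∀ ε → 0ℚ ℚ.< ε → ∃ λ N → ∀ i → N ℕ.≤ i → (+ 1 / suc i) ℚ.≤ ε
  archimedean ε@(ℚ.mkℚ (+ zero) d c) 0<ε with ℚ.positive 0<ε
  ... | ()
  archimedean ε@(ℚ.mkℚ (ℤ.-[1+ p ]) d c) 0<ε with ℚ.positive 0<ε
  ... | ()
  archimedean ε@(ℚ.mkℚ (+ suc p) d c) _ = d , λ i d≤i →
    subst ((+ 1 / suc i) ℚ.≤_) (ℚ.↥p/↧p≡p ε)
      (/-mono 1 (suc p) i d (ℕ.≤-trans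
        (ℕ.≤-reflexive (ℕ.*-identityˡ (suc d)))
        (ℕ.≤-trans (s≤s d≤i) (ℕ.m≤m+n (suc i) (p ℕ.* suc i)))))

  diff : ∀ p q {r} → p ℚ.≤ q ℚ.+ r → p ℚ.- q ℚ.≤ r
  diff p q {r} h = subst (p ℚ.- q ℚ.≤_) (cancel q r) (ℚ.+-monoˡ-≤ (ℚ.- q) h)
    where
    open ℚSolver.+-*-Solver
    cancel : ∀ u v → (u ℚ.+ v) ℚ.- u ≡ v
    cancel = solve 2 (λ u v → (u :+ v) :- u := v) refl

  ∣-∣≤ : ∀ p q r → p ℚ.≤ q ℚ.+ r → q ℚ.≤ p ℚ.+ r → ℚ.∣ p ℚ.- q ∣ ℚ.≤ r
  ∣-∣≤ p q r p≤ q≤ with ℚ.∣p∣≡p∨∣p∣≡-p (p ℚ.- q)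
  ... | inj₁ eq = subst (ℚ._≤ r) (sym eq) (diff p q p≤)
  ... | inj₂ eq = subst (ℚ._≤ r) (sym (trans eq (flip p q))) (diff q p q≤)
    where
    open ℚSolver.+-*-Solver
    flip : ∀ u v → ℚ.- (u ℚ.- v) ≡ v ℚ.- u
    flip = solve 2 (λ u v → :- (u :- v) := v :- u) refl

  √-cauchy : ∀ n → IsCauchy (√-seq n)
  √-cauchy n ε 0<ε with archimedean ε 0<ε
  ... | N , h = N , λ i j N≤i N≤j → ∣-∣≤ (√-seq n i) (√-seq n j) ε
    (ℚ.≤-trans (close n i j) (ℚ.+-monoʳ-≤ (√-seq n j) (h j N≤j)))
    (ℚ.≤-trans (close n j i) (ℚ.+-monoʳ-≤ (√-seq n i) (h i N≤i)))

√ : ℕ → ℝ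
√ n = mkℝ (√-seq n) (√-Lemmas.√-cauchy n)

record Graph (n : ℕ) : Set₁ where
  field
    Adj    : Fin n → Fin n → Set
    adj?   : Decidable₂ Adj
    symm   : Symmetric Adj
    irrefl : Irreflexive _≡_ Adj

module _ {n : ℕ} (G : Graph n) where

  open Graph G

  neighbours : Fin n → Subset n
  neighbours v = tabulate (λ w → does (adj? v w))

  degree : Fin n → ℕ
  degree v = ∣ neighbours v ∣

  -- Every degree is less than n, so the default value n of the minimum
  -- plays no role as soon as G has a vertex.
  minDegree : ℕ
  minDegree = min n (map degree (allFin n))

  -- A cycle is given by the list of its vertices in cyclic order; the
  -- first vertex is repeated at the end to impose the closing edge.
  IsCycle : List (Fin n) → Set
  IsCycle []       = ⊥
  IsCycle (v ∷ vs) =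
    3 ℕ.≤ length (v ∷ vs) × Unique (v ∷ vs) × Linked Adj ((v ∷ vs) ∷ʳ v)

  Cyclic : Subset n → Set
  Cyclic S = ∃ λ vs → IsCycle vs × (∀ v → v ∈ S ⇔ v ∈ₗ vs)

module Deciding where

  ∃-length≤? : ∀ {n} k {P : Pred (List (Fin n)) 0ℓ} → Decidable P →
    Dec (∃ λ vs → length vs ℕ.≤ k × P vs)
  ∃-length≤? zero P? = map′
    (λ p → [] , z≤n , p) (λ { ([] , _ , p) → p }) (P? [])
  ∃-length≤? (suc k) P? with P? []
  ... | yes p = yes ([] , z≤n , p)
  ... | no ¬p = map′
    (λ (v , vs , le , p) → v ∷ vs , s≤s le , p)
    (λ { ([] , _ , p) → contradiction p ¬p ; (v ∷ vs , s≤s le , p) → v , vs , le , p })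
    (Fin.any? (λ v → ∃-length≤? k (λ vs → P? (v ∷ vs))))

  vertexSet? : ∀ {n} (S : Subset n) vs → Dec (∀ v → v ∈ S ⇔ v ∈ₗ vs)
  vertexSet? S vs = Fin.all? λ v → map′
    (λ (f , g) → mk⇔ f g)
    (λ e → Equivalence.to e , Equivalence.from e)
    ((v ∈? S →-dec v ∈ₗ? vs) ×-dec (v ∈ₗ? vs →-dec v ∈? S))
    where open DecMembership Fin._≟_ using () renaming (_∈?_ to _∈ₗ?_)

  module _ {n : ℕ} (G : Graph n) where

    open Graph G

    isCycle? : Decidable (IsCycle G)
    isCycle? []       = no λ ()
    isCycle? (v ∷ vs) = 3 ℕ.≤? length (v ∷ vs)
      ×-dec DecUnique.unique? Fin._≟_ (v ∷ vs)
      ×-dec linked? adj? ((v ∷ vs) ∷ʳ v)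

    lookup-injective : ∀ {vs : List (Fin n)} → Unique vs →
      ∀ i j → lookup vs i ≡ lookup vs j → i ≡ j
    lookup-injective (_ ∷ _) zero    zero    _  = refl
    lookup-injective (p ∷ _) zero    (suc j) eq =
      contradiction eq (All.lookup p (∈-lookup j))
    lookup-injective (p ∷ _) (suc i) zero    eq =
      contradiction (sym eq) (All.lookup p (∈-lookup i))
    lookup-injective (_ ∷ u) (suc i) (suc j) eq =
      cong suc (lookup-injective u i j eq)

    length≤ : ∀ vs → IsCycle G vs → length vs ℕ.≤ n
    length≤ (v ∷ vs) (_ , u , _) = Fin.injective⇒≤ λ {i} {j} → lookup-injective u i j

cyclic? : ∀ {n} (G : Graph n) → Decidable (Cyclic G)
cyclic? {n} G S = map′
  (λ (vs , _ , p) → vs , p)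
  (λ (vs , c , e) → vs , length≤ G vs c , c , e)
  (∃-length≤? n (λ vs → isCycle? G vs ×-dec vertexSet? S vs))
  where open Deciding

subsets : ∀ n → List (Subset n)
subsets zero    = [] ∷ []
subsets (suc n) = map (inside ∷_) (subsets n) ++ map (outside ∷_) (subsets n)

Cyc : ∀ {n} → Graph n → ℕ
Cyc {n} G = length (filter (cyclic? G) (subsets n))

{-# OPTIONS --safe #-}
-- Choose S uniformly at random.  The degree condition makes a vertex v of S
-- poor, i.e. adjacent to fewer than half of S, with probability at most 1/2 - ε:
-- v is poor only if the Hamming distance from S to the neighbourhood N v, which
-- is binomially distributed, exceeds degree v ≥ n/2 + c √n.
-- So with probability bounded below the number of poor vertices of S is at most
-- (1/4 - ε) n, whereas by the fourth moment almost every S meets every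
-- neighbourhood in more vertices than that.  Such an S is cyclic: in the
-- Bondy–Chvátal closure of G[S] the remaining vertices, more than half of S,
-- first form a clique, then get joined to the poor ones, and then the closure
-- is complete.
module Submission where

open import Data.Bool.Base using (Bool; true; false; not; _∧_; _∨_; _xor_)
import Data.Bool.Properties as Bool
open import Data.Bool.Properties using (∧-comm; ∨-comm; ∨-zeroʳ)
open import Data.Empty using (⊥-elim)
open import Data.Fin.Base using (Fin; zero; suc)
open import Data.Fin.Properties using (any?)
open import Data.Fin.Subset using (Subset; ∣_∣; _∩_; ∁; ⊤)
open import Data.Fin.Subset.Properties using (∩-identityʳ; ∣⊤∣≡n)
import Data.Integer.Properties as ℤ
open import Data.List.Base
  using (List; []; _∷_; [_]; _++_; _∷ʳ_; length; reverse; map; filter; allFin)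
open import Data.List.Extrema.Nat using (min≤xs)
open import Data.List.Membership.Propositional using (_∈_)
open import Data.List.Membership.Propositional.Properties
  using (∈-++⁺ʳ; ∈-allFin; ∈-filter⁺; ∈-filter⁻; ∈-map⁺)
open import Data.List.Properties
  using (map-cong; map-tabulate; length-tabulate; unfold-reverse; reverse-++
        ; ∷-injective; ∷ʳ-injective; ++-assoc)
open import Data.List.Relation.Binary.Permutation.Propositional
  using (_↭_; ↭-trans; ↭-sym; ↭-reflexive; ↭⇒↭ₛ)
open import Data.List.Relation.Binary.Permutation.Propositional.Properties
  using (map⁺; ∈-resp-↭; ↭-length; ++-comm; ++⁺ˡ; ↭-reverse; ∷↭∷ʳ)
import Data.List.Relation.Binary.Permutation.Setoid.Properties as Permutation
import Data.List.Relation.Unary.All as All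
open import Data.List.Relation.Unary.Any using (here; there)
open import Data.List.Relation.Unary.Linked using (Linked; []; [-]; _∷_)
open import Data.List.Relation.Unary.Unique.Propositional.Properties using (allFin⁺; filter⁺)
open import Data.Nat.Base as ℕ using (ℕ; suc; s≤s; z≤n; _⊔_)
open import Data.Nat.DivMod using (m≡m%n+[m/n]*n; m%n<n)
open import Data.Nat.Induction using (<-rec)
open import Data.Nat.ListAction using (sum)
open import Data.Nat.ListAction.Properties using (sum-↭)
import Data.Nat.Properties as ℕ
open import Data.Nat.Tactic.RingSolver using (solve-∀)
open import Data.Product.Base using (∃; _×_; _,_; proj₁; proj₂)
import Data.Rational.Properties as ℚ
open import Data.Rational.Unnormalised.Base as ℚᵘ using (mkℚᵘ)
import Data.Rational.Unnormalised.Properties as ℚᵘ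
open import Data.Sum.Base using (_⊎_; inj₁; inj₂)
open import Data.Vec.Base using ([]; _∷_; lookup)
open import Data.Vec.Properties using (lookup∘tabulate; lookup-zipWith; []=⇒lookup; lookup⇒[]=)
open import Defs using (subsets; Graph; neighbours; degree; Cyclic; cyclic?; Cyc)
open import Function.Bundles using (mk⇔)
open import Level using (0ℓ)
open import Relation.Binary.PropositionalEquality
  using (_≡_; _≢_; refl; sym; trans; cong; cong₂; subst; subst₂; setoid; module ≡-Reasoning)
open import Relation.Nullary using (Dec; does; yes; no)
open import Relation.Nullary.Decidable using (dec-true; dec-false; does-⇔)
open import Relation.Unary using (Pred; Decidable)

-- Only vertices of S can count as poor, which halves the mean number of poor vertices to about
-- `(1/4 - ε/2) n`, while a neighbourhood typically meets S in about `n/4` vertices or more.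
-- Everything therefore rests on a gap ε that does not depend on `n`. It comes from convexity, with
-- no estimate of binomial coefficients: the probability that a random set has at least `x` elements
-- is convex in `x` beyond `n/2`, at most 1/2 there and at most 1/4 at distance `√n`. A chord over
-- `Q` equal steps then puts its value after one step below 1/2 by at least `1/(4Q)`, where `Q`
-- depends on `c` alone. Only the mean number of poor vertices is controlled, so Markov's inequality
-- leaves a positive proportion of the sets rather than almost all of them. The sets that meet some
-- neighbourhood badly must not use up this proportion. There are `n` neighbourhoods to control,
-- besides the size of S itself: a second moment bounds each exception by order `1/n`, which does
-- not vanish in the sum, whereas the fourth moment gives order `1/n²`.

private variable
  A B : Set

module Discrete where

  open import Data.Nat.Base
  open import Data.Nat.Properties

  -- Finite sums over lists

  ∑ : List A → (A → ℕ) → ℕ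
  ∑ xs f = sum (map f xs)

  𝟙 : Bool → ℕ
  𝟙 true  = 1
  𝟙 false = 0

  𝟙≤1 : ∀ b → 𝟙 b ≤ 1
  𝟙≤1 true  = ≤-refl
  𝟙≤1 false = z≤n

  𝟙-∧ : ∀ a b → 𝟙 (a ∧ b) ≡ 𝟙 a * 𝟙 b
  𝟙-∧ true  b = sym (*-identityˡ (𝟙 b))
  𝟙-∧ false b = refl

  ∑-cong : ∀ {f g : A → ℕ} xs → (∀ x → f x ≡ g x) → ∑ xs f ≡ ∑ xs g
  ∑-cong xs f≗g = cong sum (map-cong f≗g xs)

  ∑-mono : ∀ {f g : A → ℕ} xs → (∀ x → f x ≤ g x) → ∑ xs f ≤ ∑ xs g
  ∑-mono []       f≤g = z≤n
  ∑-mono (x ∷ xs) f≤g = +-mono-≤ (f≤g x) (∑-mono xs f≤g)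

  ∑-+ : ∀ (f g : A → ℕ) xs → ∑ xs (λ x → f x + g x) ≡ ∑ xs f + ∑ xs g
  ∑-+ f g []       = refl
  ∑-+ f g (x ∷ xs) = trans (cong (f x + g x +_) (∑-+ f g xs)) (swap (f x) (g x) (∑ xs f) (∑ xs g))
    where
    swap : ∀ a b c d → (a + b) + (c + d) ≡ (a + c) + (b + d)
    swap = solve-∀

  ∑-*ˡ : ∀ c (f : A → ℕ) xs → ∑ xs (λ x → c * f x) ≡ c * ∑ xs f
  ∑-*ˡ c f []       = sym (*-zeroʳ c)
  ∑-*ˡ c f (x ∷ xs) = trans (cong (c * f x +_) (∑-*ˡ c f xs)) (sym (*-distribˡ-+ c (f x) (∑ xs f)))

  ∑-const : ∀ c (xs : List A) → ∑ xs (λ _ → c) ≡ length xs * c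
  ∑-const c []       = refl
  ∑-const c (x ∷ xs) = cong (c +_) (∑-const c xs)

  ∑-zero : ∀ (xs : List A) → ∑ xs (λ _ → 0) ≡ 0
  ∑-zero xs = trans (∑-const 0 xs) (*-zeroʳ (length xs))

  ∑-swap : ∀ (f : A → B → ℕ) xs ys → ∑ xs (λ x → ∑ ys (f x)) ≡ ∑ ys (λ y → ∑ xs (λ x → f x y))
  ∑-swap f []       ys = sym (∑-zero ys)
  ∑-swap f (x ∷ xs) ys = trans (cong (∑ ys (f x) +_) (∑-swap f xs ys))
    (sym (∑-+ (f x) (λ y → ∑ xs (λ x → f x y)) ys))

  ∑-++ : ∀ (f : A → ℕ) xs ys → ∑ (xs ++ ys) f ≡ ∑ xs f + ∑ ys f
  ∑-++ f []       ys = refl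
  ∑-++ f (x ∷ xs) ys = trans (cong (f x +_) (∑-++ f xs ys)) (sym (+-assoc (f x) (∑ xs f) (∑ ys f)))

  ∑-map : ∀ (f : B → ℕ) (g : A → B) xs → ∑ (map g xs) f ≡ ∑ xs (λ x → f (g x))
  ∑-map f g []       = refl
  ∑-map f g (x ∷ xs) = cong (f (g x) +_) (∑-map f g xs)

  ∑-↭ : ∀ (f : A → ℕ) {xs ys} → xs ↭ ys → ∑ xs f ≡ ∑ ys f
  ∑-↭ f p = sum-↭ (map⁺ f p)

  ∑-filter : ∀ {P : Pred A 0ℓ} (P? : Decidable P) (f : A → ℕ) xs →
    ∑ (filter P? xs) f ≡ ∑ xs (λ x → 𝟙 (does (P? x)) * f x)
  ∑-filter P? f []       = refl
  ∑-filter P? f (x ∷ xs) with P? x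
  ... | yes _ = cong₂ _+_ (sym (*-identityˡ (f x))) (∑-filter P? f xs)
  ... | no  _ = ∑-filter P? f xs

  length-filter : ∀ {P : Pred A 0ℓ} (P? : Decidable P) xs →
    length (filter P? xs) ≡ ∑ xs (λ x → 𝟙 (does (P? x)))
  length-filter P? []       = refl
  length-filter P? (x ∷ xs) with P? x
  ... | yes _ = cong suc (length-filter P? xs)
  ... | no  _ = length-filter P? xs

  cnt : (A → Bool) → List A → ℕ
  cnt p xs = ∑ xs (λ x → 𝟙 (p x))

  cnt-not : ∀ (p : A → Bool) xs → cnt p xs + cnt (λ x → not (p x)) xs ≡ length xs
  cnt-not p []       = refl
  cnt-not p (x ∷ xs) with p x
  ... | true  = cong suc (cnt-not p xs)
  ... | false = trans (+-suc (cnt p xs) _) (cong suc (cnt-not p xs))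

  -- Hamiltonian cycles by closure

  last-of-suffix : ∀ {i : List A} {u z b} w → i ∷ʳ u ≡ w ++ z ∷ b → ∃ λ j → z ∷ b ≡ j ∷ʳ u
  last-of-suffix {i = i}           []      eq = i , sym eq
  last-of-suffix {i = _ ∷ i}       (_ ∷ w) eq = last-of-suffix w (proj₂ (∷-injective eq))
  last-of-suffix {i = []}          (_ ∷ w) eq = ⊥-elim (no-end w (proj₂ (∷-injective eq)))
    where
    no-end : ∀ {z : A} {b} w → [] ≢ w ++ z ∷ b
    no-end []      ()
    no-end (_ ∷ _) ()

  lastOf : A → List A → A
  lastOf x []       = x
  lastOf x (y ∷ xs) = lastOf y xs

  lastOf-∷ʳ : ∀ {x u : A} {xs} i → x ∷ xs ≡ i ∷ʳ u → lastOf x xs ≡ u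
  lastOf-∷ʳ {xs = []}     []          refl = refl
  lastOf-∷ʳ {xs = []}     (_ ∷ [])    ()
  lastOf-∷ʳ {xs = []}     (_ ∷ _ ∷ _) ()
  lastOf-∷ʳ {xs = y ∷ xs} (_ ∷ i)     eq = lastOf-∷ʳ i (proj₂ (∷-injective eq))

  -- A walk is a list without defects. Counting the failures, instead of forbidding them, gives the
  -- closure argument a quantity to induct on.
  defects : (A → A → Bool) → List A → ℕ
  defects H []           = 0
  defects H (x ∷ [])     = 0
  defects H (x ∷ y ∷ xs) = 𝟙 (not (H x y)) + defects H (y ∷ xs)

  closed : A → List A → List A
  closed x xs = x ∷ xs ∷ʳ x

  module _ (H : A → A → Bool) where

    defects-++ : ∀ xs y zs → defects H (xs ++ y ∷ zs) ≡ defects H (xs ∷ʳ y) + defects H (y ∷ zs)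
    defects-++ []            y zs = refl
    defects-++ (x ∷ [])      y zs = cong (_+ defects H (y ∷ zs)) (sym (+-identityʳ (𝟙 (not (H x y)))))
    defects-++ (x ∷ x′ ∷ xs) y zs = trans (cong (𝟙 (not (H x x′)) +_) (defects-++ (x′ ∷ xs) y zs))
      (sym (+-assoc (𝟙 (not (H x x′))) _ _))

    defects-reverse : (∀ x y → H x y ≡ H y x) → ∀ xs → defects H (reverse xs) ≡ defects H xs
    defects-reverse H-sym []           = refl
    defects-reverse H-sym (x ∷ [])     = refl
    defects-reverse H-sym (x ∷ y ∷ xs) = begin
      defects H (reverse (x ∷ y ∷ xs))
        ≡⟨ cong (defects H) (trans (unfold-reverse x (y ∷ xs)) (cong (_∷ʳ x) (unfold-reverse y xs))) ⟩
      defects H ((reverse xs ∷ʳ y) ∷ʳ x)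
        ≡⟨ cong (defects H) (++-assoc (reverse xs) [ y ] [ x ]) ⟩
      defects H (reverse xs ++ y ∷ [ x ])
        ≡⟨ defects-++ (reverse xs) y [ x ] ⟩
      defects H (reverse xs ∷ʳ y) + (𝟙 (not (H y x)) + 0)
        ≡⟨ cong₂ _+_ (trans (cong (defects H) (sym (unfold-reverse y xs))) (defects-reverse H-sym (y ∷ xs)))
                     (trans (+-identityʳ _) (cong (λ b → 𝟙 (not b)) (H-sym y x))) ⟩
      defects H (y ∷ xs) + 𝟙 (not (H x y))
        ≡⟨ +-comm (defects H (y ∷ xs)) _ ⟩
      defects H (x ∷ y ∷ xs) ∎
      where open ≡-Reasoning

    find-defect : ∀ xs → defects H xs ≢ 0 →
      ∃ λ p → ∃ λ u → ∃ λ v → ∃ λ q → xs ≡ p ++ u ∷ v ∷ q × H u v ≡ false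
    find-defect []           ne = ⊥-elim (ne refl)
    find-defect (x ∷ [])     ne = ⊥-elim (ne refl)
    find-defect (x ∷ y ∷ xs) ne with H x y in eq | find-defect (y ∷ xs)
    ... | false | _   = [] , x , y , xs , refl , eq
    ... | true  | rec with rec ne
    ...   | p , u , v , q , eq′ , h = x ∷ p , u , v , q , cong (x ∷_) eq′ , h

    -- If the first alternative fails, then for consecutive `y`, `z` at most one of `uy` and `vz` is
    -- an edge, so each of the `length xs` pairs contributes at most one to the two counts. The last
    -- vertex has no successor and leaves its own term.
    crossing : ∀ u v x xs →
      (∃ λ a → ∃ λ y → ∃ λ z → ∃ λ b → x ∷ xs ≡ a ++ y ∷ z ∷ b × H u y ≡ true × H v z ≡ true)
      ⊎ cnt (H v) xs + cnt (H u) (x ∷ xs) ≤ length xs + 𝟙 (H u (lastOf x xs))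
    crossing u v x []       = inj₂ (≤-reflexive (+-identityʳ (𝟙 (H u x))))
    crossing u v x (z ∷ xs) with crossing u v z xs
    ... | inj₁ (a , y , z′ , b , eq , h , h′) = inj₁ (x ∷ a , y , z′ , b , cong (x ∷_) eq , h , h′)
    ... | inj₂ le with H u x in eqx | H v z in eqz
    ...   | true  | true  = inj₁ ([] , x , z , xs , refl , eqx , eqz)
    ...   | true  | false = inj₂ (≤-trans (≤-reflexive (+-suc (cnt (H v) xs) _)) (s≤s le))
    ...   | false | true  = inj₂ (s≤s le)
    ...   | false | false = inj₂ (m≤n⇒m≤1+n le)

  module _ (H H′ : A → A → Bool) where

    -- Removes a defect uv from a cycle, leaving a path from v to u.
    open-at-defect : ∀ x xs → defects H′ (closed x xs) ≡ 0 → defects H (closed x xs) ≢ 0 →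
      ∃ λ u → ∃ λ v → ∃ λ t → ∃ λ i →
        v ∷ t ↭ x ∷ xs × v ∷ t ≡ i ∷ʳ u × H u v ≡ false × H′ u v ≡ true
        × suc (defects H (v ∷ t)) ≡ defects H (closed x xs) × defects H′ (v ∷ t) ≡ 0
    open-at-defect x xs h′ ne with find-defect H (closed x xs) ne
    ... | p , u , v , q , eq , bad = result
      where
      not-true : ∀ {b} → 𝟙 (not b) ≡ 0 → b ≡ true
      not-true {true} _ = refl

      split : ∀ H → defects H (closed x xs) ≡ defects H (p ∷ʳ u) + (𝟙 (not (H u v)) + defects H (v ∷ q))
      split H = trans (cong (defects H) eq) (defects-++ H p u (v ∷ q))

      zero-parts : defects H′ (p ∷ʳ u) + (𝟙 (not (H′ u v)) + defects H′ (v ∷ q)) ≡ 0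
      zero-parts = trans (sym (split H′)) h′

      H′uv : H′ u v ≡ true
      H′uv = not-true (m+n≡0⇒m≡0 _ (m+n≡0⇒n≡0 (defects H′ (p ∷ʳ u)) zero-parts))

      head-u : ∃ λ w → p ∷ʳ u ≡ x ∷ w × xs ∷ʳ x ≡ w ++ v ∷ q
      head-u = go p eq
        where
        go : ∀ p → closed x xs ≡ p ++ u ∷ v ∷ q → ∃ λ w → p ∷ʳ u ≡ x ∷ w × xs ∷ʳ x ≡ w ++ v ∷ q
        go []      eq with refl , eq′ ← ∷-injective eq = [] , refl , eq′
        go (_ ∷ p) eq with refl , eq′ ← ∷-injective eq = p ∷ʳ u , refl , trans eq′ (sym (++-assoc p [ u ] (v ∷ q)))

      w = proj₁ head-u

      last-x : ∃ λ j → v ∷ q ≡ j ∷ʳ x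
      last-x = last-of-suffix w (proj₂ (proj₂ head-u))

      j = proj₁ last-x

      -- The closed list runs `x … u v … x`. Cut between `u` and `v` and glued at `x`, it becomes
      -- the path `v … x … u`.
      path≡ : v ∷ q ++ w ≡ j ++ x ∷ w
      path≡ = trans (cong (_++ w) (proj₂ last-x)) (++-assoc j [ x ] w)

      path-defects : ∀ H → defects H (v ∷ q ++ w) ≡ defects H (v ∷ q) + defects H (p ∷ʳ u)
      path-defects H = begin
        defects H (v ∷ q ++ w)                    ≡⟨ cong (defects H) path≡ ⟩
        defects H (j ++ x ∷ w)                    ≡⟨ defects-++ H j x w ⟩
        defects H (j ∷ʳ x) + defects H (x ∷ w)
          ≡⟨ cong₂ _+_ (cong (defects H) (sym (proj₂ last-x))) (cong (defects H) (sym (proj₁ (proj₂ head-u)))) ⟩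
        defects H (v ∷ q) + defects H (p ∷ʳ u)    ∎
        where open ≡-Reasoning

      perm : v ∷ q ++ w ↭ x ∷ xs
      perm = ↭-trans (++-comm (v ∷ q) w)
        (↭-trans (↭-reflexive (sym (proj₂ (proj₂ head-u)))) (↭-sym (∷↭∷ʳ x xs)))

      result : ∃ λ u → ∃ λ v → ∃ λ t → ∃ λ i →
        v ∷ t ↭ x ∷ xs × v ∷ t ≡ i ∷ʳ u × H u v ≡ false × H′ u v ≡ true
        × suc (defects H (v ∷ t)) ≡ defects H (closed x xs) × defects H′ (v ∷ t) ≡ 0
      result = u , v , q ++ w , j ++ p , perm
        , trans path≡ (trans (cong (j ++_) (sym (proj₁ (proj₂ head-u)))) (sym (++-assoc j p [ u ])))
        , bad , H′uv
        , trans (cong suc (path-defects H)) (trans (rearrange (defects H (v ∷ q)) (defects H (p ∷ʳ u)))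
            (trans (cong (λ b → defects H (p ∷ʳ u) + (𝟙 (not b) + defects H (v ∷ q))) (sym bad)) (sym (split H))))
        , trans (path-defects H′) (cong₂ _+_
            (m+n≡0⇒n≡0 (𝟙 (not (H′ u v))) (m+n≡0⇒n≡0 (defects H′ (p ∷ʳ u)) zero-parts))
            (m+n≡0⇒m≡0 _ zero-parts))
        where
        rearrange : ∀ a b → suc (a + b) ≡ b + (1 + a)
        rearrange = solve-∀

  module _ (K : A → A → Bool) (K-sym : ∀ x y → K x y ≡ K y x) where

    -- With the edges uy and vz, a path a y z b from v to u closes up to
    -- the cycle a y (reverse of z b).
    reconnect : ∀ {v t u i a y z b xs} → v ∷ t ≡ i ∷ʳ u → v ∷ t ≡ a ++ y ∷ z ∷ b →
      v ∷ xs ≡ a ++ y ∷ reverse (z ∷ b) → K u y ≡ true → K v z ≡ true →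
      defects K (closed v xs) ≤ defects K (v ∷ t)
    reconnect {v} {t} {u} {i} {a} {y} {z} {b} {xs} eq-i eq-a eq-xs Kuy Kvz = begin
      defects K ((v ∷ xs) ∷ʳ v)
        ≡⟨ cong (λ l → defects K (l ∷ʳ v)) eq-xs ⟩
      defects K ((a ++ y ∷ reverse (z ∷ b)) ∷ʳ v)
        ≡⟨ cong (defects K) (++-assoc a (y ∷ reverse (z ∷ b)) [ v ]) ⟩
      defects K (a ++ y ∷ (reverse (z ∷ b) ∷ʳ v))
        ≡⟨ defects-++ K a y (reverse (z ∷ b) ∷ʳ v) ⟩
      defects K (a ∷ʳ y) + defects K (y ∷ (reverse (z ∷ b) ∷ʳ v))
        ≡⟨ cong (defects K (a ∷ʳ y) +_) second ⟩
      -- The edge `yz` of the path is dropped, whether or not it was a defect; the new edges `yu`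
      -- and `zv` cost nothing.
      defects K (a ∷ʳ y) + defects K (z ∷ b)
        ≤⟨ +-monoʳ-≤ (defects K (a ∷ʳ y)) (m≤n+m (defects K (z ∷ b)) (𝟙 (not (K y z)))) ⟩
      defects K (a ∷ʳ y) + (𝟙 (not (K y z)) + defects K (z ∷ b))
        ≡⟨ trans (cong (defects K) eq-a) (defects-++ K a y (z ∷ b)) ⟨
      defects K (v ∷ t) ∎
      where
      open ≤-Reasoning

      last-u : ∃ λ j → z ∷ b ≡ j ∷ʳ u
      last-u = last-of-suffix (a ∷ʳ y) (trans (sym eq-i) (trans eq-a (sym (++-assoc a [ y ] (z ∷ b)))))

      starts-u : ∃ λ r → reverse (z ∷ b) ≡ u ∷ r
      starts-u = _ , trans (cong reverse (proj₂ last-u)) (reverse-++ (proj₁ last-u) [ u ])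

      first-edge : ∀ l → (∃ λ r → l ≡ u ∷ r) → defects K (y ∷ (l ∷ʳ v)) ≡ defects K (l ∷ʳ v)
      first-edge l (r , refl) rewrite K-sym y u | Kuy = refl

      second : defects K (y ∷ (reverse (z ∷ b) ∷ʳ v)) ≡ defects K (z ∷ b)
      second = begin-equality
        defects K (y ∷ (reverse (z ∷ b) ∷ʳ v))   ≡⟨ first-edge _ starts-u ⟩
        defects K (reverse (z ∷ b) ∷ʳ v)
          ≡⟨ cong (λ l → defects K (l ∷ʳ v)) (unfold-reverse z b) ⟩
        defects K ((reverse b ∷ʳ z) ∷ʳ v)        ≡⟨ cong (defects K) (++-assoc (reverse b) [ z ] [ v ]) ⟩
        defects K (reverse b ++ z ∷ [ v ])       ≡⟨ defects-++ K (reverse b) z [ v ] ⟩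
        defects K (reverse b ∷ʳ z) + (𝟙 (not (K z v)) + 0)
          ≡⟨ cong₂ _+_ (cong (defects K) (sym (unfold-reverse z b)))
               (cong (λ c → 𝟙 (not c) + 0) (trans (K-sym z v) Kvz)) ⟩
        defects K (reverse (z ∷ b)) + 0          ≡⟨ +-identityʳ _ ⟩
        defects K (reverse (z ∷ b))              ≡⟨ defects-reverse K K-sym (z ∷ b) ⟩
        defects K (z ∷ b)                        ∎

  same-head : ∀ {v : A} {t} a {y r} r′ → v ∷ t ≡ a ++ y ∷ r → ∃ λ xs → v ∷ xs ≡ a ++ y ∷ r′
  same-head []      r′ refl = r′ , refl
  same-head (_ ∷ a) r′ refl = a ++ _ ∷ r′ , refl

  -- Bondy–Chvátal closure, with loops of H allowed but not counted in degrees.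
  module _ (H H′ : A → A → Bool)
           (H-sym : ∀ x y → H x y ≡ H y x) (H′-sym : ∀ x y → H′ x y ≡ H′ y x)
           (H⊆H′ : ∀ x y → H x y ≡ true → H′ x y ≡ true)
           (xs₀ : List A)
           (degrees : ∀ u v → u ∈ xs₀ → v ∈ xs₀ → H′ u v ≡ true → H u v ≡ false →
             length xs₀ + (𝟙 (H u u) + 𝟙 (H v v)) ≤ cnt (H u) xs₀ + cnt (H v) xs₀) where

    -- Cutting at a non-edge `uv` of `H` lowers the number of defects. The degree sum of `u` and `v`
    -- forces a crossing on the resulting path, and closing up through it uses two edges of `H`,
    -- which adds no defect in `H` or in `H′`.
    remove-defect : ∀ x xs → x ∷ xs ↭ xs₀ → defects H′ (closed x xs) ≡ 0 → defects H (closed x xs) ≢ 0 →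
      ∃ λ y → ∃ λ ys → y ∷ ys ↭ xs₀ × defects H′ (closed y ys) ≡ 0
        × defects H (closed y ys) < defects H (closed x xs)
    remove-defect x xs p h′ ne with open-at-defect H H′ x xs h′ ne
    ... | u , v , t , i , perm , eq-i , Huv , H′uv , eq-d , eq-d′ with crossing H u v v t
    ...   | inj₁ (a , y , z , b , eq-a , Huy , Hvz) with same-head a (reverse (z ∷ b)) eq-a
    ...     | ys , eq-ys = v , ys , perm′
        , n≤0⇒n≡0 (subst (defects H′ (closed v ys) ≤_) eq-d′
            (reconnect H′ H′-sym eq-i eq-a eq-ys (H⊆H′ u y Huy) (H⊆H′ v z Hvz)))
        , subst (defects H (closed v ys) <_) eq-d (s≤s (reconnect H H-sym eq-i eq-a eq-ys Huy Hvz))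
      where
      perm′ : v ∷ ys ↭ xs₀
      perm′ = ↭-trans (↭-reflexive eq-ys)
        (↭-trans (++⁺ˡ a (_↭_.prep y (↭-reverse (z ∷ b))))
        (↭-trans (↭-reflexive (sym eq-a)) (↭-trans perm p)))
    remove-defect x xs p h′ ne | u , v , t , i , perm , eq-i , Huv , H′uv , eq-d , eq-d′ | inj₂ few =
      ⊥-elim (<⇒≱ (n<1+n (length t + (𝟙 (H u u) + 𝟙 (H v v)))) (begin
        suc (length t) + (𝟙 (H u u) + 𝟙 (H v v))
          ≡⟨ cong (_+ (𝟙 (H u u) + 𝟙 (H v v))) (↭-length perm′) ⟩
        length xs₀ + (𝟙 (H u u) + 𝟙 (H v v))
          ≤⟨ degrees u v u∈ v∈ H′uv Huv ⟩
        cnt (H u) xs₀ + cnt (H v) xs₀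
          ≡⟨ cong₂ _+_ (∑-↭ _ perm′) (∑-↭ _ perm′) ⟨
        cnt (H u) (v ∷ t) + (𝟙 (H v v) + cnt (H v) t)
          ≡⟨ rearrange (cnt (H u) (v ∷ t)) (𝟙 (H v v)) (cnt (H v) t) ⟩
        (cnt (H v) t + cnt (H u) (v ∷ t)) + 𝟙 (H v v)
          ≤⟨ +-monoˡ-≤ (𝟙 (H v v)) few ⟩
        -- The path ends in `u`, so the boundary term of `crossing` is the loop at `u`, which the
        -- degree hypothesis discounts.
        (length t + 𝟙 (H u (lastOf v t))) + 𝟙 (H v v)
          ≡⟨ cong (λ w → (length t + 𝟙 (H u w)) + 𝟙 (H v v)) (lastOf-∷ʳ i eq-i) ⟩
        (length t + 𝟙 (H u u)) + 𝟙 (H v v)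
          ≡⟨ +-assoc (length t) _ _ ⟩
        length t + (𝟙 (H u u) + 𝟙 (H v v)) ∎))
      where
      open ≤-Reasoning
      perm′ : v ∷ t ↭ xs₀
      perm′ = ↭-trans perm p
      v∈ : v ∈ xs₀
      v∈ = ∈-resp-↭ perm′ (here refl)
      u∈ : u ∈ xs₀
      u∈ = ∈-resp-↭ perm′ (subst (u ∈_) (sym eq-i) (∈-++⁺ʳ i (here refl)))
      rearrange : ∀ a b c → a + (b + c) ≡ (c + a) + b
      rearrange = solve-∀

    -- Strong induction on the number of defects in `H`, along cycles that stay inside `H′`.
    closure : ∀ x xs → x ∷ xs ↭ xs₀ → defects H′ (closed x xs) ≡ 0 →
      ∃ λ y → ∃ λ ys → y ∷ ys ↭ xs₀ × defects H (closed y ys) ≡ 0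
    closure x xs p h′ = <-rec
      (λ k → ∀ x xs → defects H (closed x xs) ≡ k → x ∷ xs ↭ xs₀ → defects H′ (closed x xs) ≡ 0 →
        ∃ λ y → ∃ λ ys → y ∷ ys ↭ xs₀ × defects H (closed y ys) ≡ 0)
      (λ { zero    rec x xs eq p h′ → x , xs , p , eq
         ; (suc k) rec x xs eq p h′ →
             let y , ys , q , g′ , drop = remove-defect x xs p h′ λ eq₀ → 0≢1+n (trans (sym eq₀) eq)
             in rec (subst (defects H (closed y ys) <_) eq drop) y ys refl q g′ })
      _ x xs refl p h′

  ∨-mono-∨ : ∀ {a b c} → (b ≡ true → c ≡ true) → a ∨ b ≡ true → a ∨ c ≡ true
  ∨-mono-∨ {true}  h eq = refl
  ∨-mono-∨ {false} h eq = h eq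

  true≢false : true ≢ false
  true≢false ()

  ∨-true≢false : ∀ a → a ∨ true ≢ false
  ∨-true≢false a eq = true≢false (trans (sym (∨-zeroʳ a)) eq)

  ∧⇒∨ : ∀ {a b} → a ∧ b ≡ true → a ∨ b ≡ true
  ∧⇒∨ {true} _ = refl

  𝟙-∨ˡ : ∀ a b → 𝟙 a ≤ 𝟙 (a ∨ b)
  𝟙-∨ˡ true  b = ≤-refl
  𝟙-∨ˡ false b = z≤n

  𝟙-∨ʳ : ∀ a b → 𝟙 b ≤ 𝟙 (a ∨ b)
  𝟙-∨ʳ true  b = 𝟙≤1 b
  𝟙-∨ʳ false b = ≤-refl

  -- The closure acquires first the pairs inside α, then those meeting α, then all.
  module _ (adj : A → A → Bool) (adj-sym : ∀ x y → adj x y ≡ adj y x)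
           (adj-irrefl : ∀ x → adj x x ≡ false) (α : A → Bool) (xs : List A)
           (half : ∀ u → u ∈ xs → α u ≡ true → length xs ≤ 2 * cnt (adj u) xs)
           (few-exceptions : ∀ u → u ∈ xs → cnt (λ y → not (α y)) xs < cnt (adj u) xs)
           (majority : 2 * cnt (λ y → not (α y)) xs ≤ length xs) where

    private
      H₁ H₂ H₃ : A → A → Bool
      H₁ u v = adj u v ∨ (α u ∧ α v)
      H₂ u v = adj u v ∨ (α u ∨ α v)
      H₃ u v = true

      b m : ℕ
      b = cnt (λ y → not (α y)) xs
      m = length xs

      ∑α : cnt α xs + b ≡ m
      ∑α = cnt-not α xs

      H₁-sym : ∀ u v → H₁ u v ≡ H₁ v u
      H₁-sym u v = cong₂ _∨_ (adj-sym u v) (∧-comm (α u) (α v))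

      H₂-sym : ∀ u v → H₂ u v ≡ H₂ v u
      H₂-sym u v = cong₂ _∨_ (adj-sym u v) (∨-comm (α u) (α v))

      deg-α : ∀ u → α u ≡ true → cnt α xs ≤ cnt (H₁ u) xs
      deg-α u αu = ∑-mono xs λ y → subst (λ a → 𝟙 (α y) ≤ 𝟙 (adj u y ∨ (a ∧ α y))) (sym αu) (𝟙-∨ʳ (adj u y) (α y))

      adj≤H₁ : ∀ u → cnt (adj u) xs ≤ cnt (H₁ u) xs
      adj≤H₁ u = ∑-mono xs λ y → 𝟙-∨ˡ (adj u y) (α u ∧ α y)

      -- In `H₁` the vertex `u` sees all of `α`, its own loop included, and `v` sees more than `b`
      -- vertices. The strictness of `few-exceptions` pays for the loop.
      one-α : ∀ u v → v ∈ xs → α u ≡ true → α v ≡ false →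
        m + (𝟙 (H₁ u u) + 𝟙 (H₁ v v)) ≤ cnt (H₁ u) xs + cnt (H₁ v) xs
      one-α u v v∈ αu αv = begin
        m + (𝟙 (H₁ u u) + 𝟙 (H₁ v v))  ≡⟨ cong (m +_) (cong₂ _+_ loop-u loop-v) ⟩
        m + 1                          ≡⟨ cong (_+ 1) ∑α ⟨
        (cnt α xs + b) + 1             ≡⟨ trans (+-assoc (cnt α xs) b 1) (cong (cnt α xs +_) (+-comm b 1)) ⟩
        cnt α xs + suc b               ≤⟨ +-mono-≤ (deg-α u αu) (≤-trans (few-exceptions v v∈) (adj≤H₁ v)) ⟩
        cnt (H₁ u) xs + cnt (H₁ v) xs  ∎
        where
        open ≤-Reasoning
        loop-u : 𝟙 (H₁ u u) ≡ 1
        loop-u rewrite adj-irrefl u | αu = refl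
        loop-v : 𝟙 (H₁ v v) ≡ 0
        loop-v rewrite adj-irrefl v | αv = refl

      -- A pair of `H₁` that is not an edge lies inside `α`, and each of its ends is adjacent to at
      -- least half of `xs`.
      degrees₀ : ∀ u v → u ∈ xs → v ∈ xs → H₁ u v ≡ true → adj u v ≡ false →
        m + (𝟙 (adj u u) + 𝟙 (adj v v)) ≤ cnt (adj u) xs + cnt (adj v) xs
      degrees₀ u v u∈ v∈ h₁ h with adj u v | α u in αu | α v in αv
      degrees₀ u v u∈ v∈ h₁ refl | false | true | true = begin
        m + (𝟙 (adj u u) + 𝟙 (adj v v))  ≡⟨ cong (m +_) (cong₂ _+_ (cong 𝟙 (adj-irrefl u)) (cong 𝟙 (adj-irrefl v))) ⟩
        m + 0                            ≡⟨ +-identityʳ m ⟩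
        m                                ≤⟨ *-cancelˡ-≤ 2 double ⟩
        cnt (adj u) xs + cnt (adj v) xs  ∎
        where
        open ≤-Reasoning
        double : 2 * m ≤ 2 * (cnt (adj u) xs + cnt (adj v) xs)
        double = begin
          2 * m    ≡⟨ cong (m +_) (+-identityʳ m) ⟩
          m + m    ≤⟨ +-mono-≤ (half u u∈ αu) (half v v∈ αv) ⟩
          2 * cnt (adj u) xs + 2 * cnt (adj v) xs ≡⟨ *-distribˡ-+ 2 (cnt (adj u) xs) _ ⟨
          2 * (cnt (adj u) xs + cnt (adj v) xs) ∎

      degrees₁ : ∀ u v → u ∈ xs → v ∈ xs → H₂ u v ≡ true → H₁ u v ≡ false →
        m + (𝟙 (H₁ u u) + 𝟙 (H₁ v v)) ≤ cnt (H₁ u) xs + cnt (H₁ v) xs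
      degrees₁ u v u∈ v∈ h₂ h₁ = by-cases (α u) (α v) refl refl h₂ h₁
        where
        by-cases : ∀ a c → α u ≡ a → α v ≡ c → adj u v ∨ (a ∨ c) ≡ true → adj u v ∨ (a ∧ c) ≡ false →
          m + (𝟙 (H₁ u u) + 𝟙 (H₁ v v)) ≤ cnt (H₁ u) xs + cnt (H₁ v) xs
        by-cases true  true  αu αv h₂ h₁ = ⊥-elim (∨-true≢false (adj u v) h₁)
        by-cases true  false αu αv h₂ h₁ = one-α u v v∈ αu αv
        by-cases false true  αu αv h₂ h₁ = subst₂ _≤_
          (cong (m +_) (+-comm (𝟙 (H₁ v v)) _)) (+-comm (cnt (H₁ v) xs) _) (one-α v u u∈ αv αu)
        by-cases false false αu αv h₂ h₁ = ⊥-elim (true≢false (trans (sym h₂) h₁))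

      -- A pair missing from `H₂` avoids `α`, but both ends are joined in `H₂` to all of `α`, which
      -- is at least half of `xs` by `majority`.
      degrees₂ : ∀ u v → u ∈ xs → v ∈ xs → H₃ u v ≡ true → H₂ u v ≡ false →
        m + (𝟙 (H₂ u u) + 𝟙 (H₂ v v)) ≤ cnt (H₂ u) xs + cnt (H₂ v) xs
      degrees₂ u v u∈ v∈ _ h₂ = by-cases (α u) (α v) refl refl h₂
        where
        loop : ∀ w → α w ≡ false → 𝟙 (H₂ w w) ≡ 0
        loop w αw rewrite adj-irrefl w | αw = refl
        cntα : ∀ w → cnt α xs ≤ cnt (H₂ w) xs
        cntα w = ∑-mono xs λ y → ≤-trans (𝟙-∨ʳ (α w) (α y)) (𝟙-∨ʳ (adj w y) (α w ∨ α y))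
        by-cases : ∀ a c → α u ≡ a → α v ≡ c → adj u v ∨ (a ∨ c) ≡ false →
          m + (𝟙 (H₂ u u) + 𝟙 (H₂ v v)) ≤ cnt (H₂ u) xs + cnt (H₂ v) xs
        by-cases true  c     αu αv h = ⊥-elim (∨-true≢false (adj u v) h)
        by-cases false true  αu αv h = ⊥-elim (∨-true≢false (adj u v) h)
        by-cases false false αu αv h = begin
          m + (𝟙 (H₂ u u) + 𝟙 (H₂ v v))  ≡⟨ cong (m +_) (cong₂ _+_ (loop u αu) (loop v αv)) ⟩
          m + 0                          ≡⟨ trans (+-identityʳ m) (sym ∑α) ⟩
          cnt α xs + b                   ≤⟨ +-monoʳ-≤ (cnt α xs) b≤ ⟩
          cnt α xs + cnt α xs            ≤⟨ +-mono-≤ (cntα u) (cntα v) ⟩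
          cnt (H₂ u) xs + cnt (H₂ v) xs  ∎
          where
          open ≤-Reasoning
          b≤ : b ≤ cnt α xs
          b≤ = +-cancelʳ-≤ b b (cnt α xs) (begin
            b + b          ≡⟨ cong (b +_) (+-identityʳ b) ⟨
            2 * b          ≤⟨ majority ⟩
            m              ≡⟨ ∑α ⟨
            cnt α xs + b   ∎)

    -- Every ordering is a cycle of the complete relation `H₃`; three applications of `closure`
    -- bring a cycle down through `H₂` and `H₁` to `adj`.
    hamiltonian : ∀ {x xs′} → xs ≡ x ∷ xs′ →
      ∃ λ y → ∃ λ ys → y ∷ ys ↭ xs × defects adj (closed y ys) ≡ 0
    hamiltonian {x} {xs′} eq =
      let _ , _ , p₂ , e₂ = closure H₂ H₃ H₂-sym (λ _ _ → refl) (λ _ _ _ → refl) xs degrees₂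
                              x xs′ (↭-reflexive (sym eq)) (complete (closed x xs′))
          _ , _ , p₁ , e₁ = closure H₁ H₂ H₁-sym H₂-sym (λ u v → ∨-mono-∨ {adj u v} (∧⇒∨ {α u})) xs degrees₁
                              _ _ p₂ e₂
      in closure adj H₁ adj-sym H₁-sym (λ u v h → cong (_∨ _) h) xs degrees₀ _ _ p₁ e₁
      where
      complete : ∀ l → defects H₃ l ≡ 0
      complete []           = refl
      complete (x ∷ [])     = refl
      complete (x ∷ y ∷ l)  = complete (y ∷ l)

  -- Counting subsets

  ∑-subsets : ∀ n (f : Subset (suc n) → ℕ) → ∑ (subsets (suc n)) f ≡
    ∑ (subsets n) (λ S → f (true ∷ S)) + ∑ (subsets n) (λ S → f (false ∷ S))
  ∑-subsets n f = trans (∑-++ f (map (true ∷_) (subsets n)) (map (false ∷_) (subsets n)))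
    (cong₂ _+_ (∑-map f (true ∷_) (subsets n)) (∑-map f (false ∷_) (subsets n)))

  ∑-subsets-const : ∀ n c → ∑ (subsets n) (λ _ → c) ≡ 2 ^ n * c
  ∑-subsets-const zero    c = refl
  ∑-subsets-const (suc n) c = trans (∑-subsets n (λ _ → c))
    (trans (cong₂ _+_ (∑-subsets-const n c) (∑-subsets-const n c)) (double (2 ^ n) c))
    where
    double : ∀ a c → a * c + a * c ≡ 2 * a * c
    double = solve-∀

  -- The indicator of d ≤ m, in a form that reduces on successors.
  at-least : ℕ → ℕ → ℕ
  at-least d m = 𝟙 (d <ᵇ suc m)

  exactly : ℕ → ℕ → ℕ
  exactly d m = 𝟙 (d ≡ᵇ m)

  at-least-split : ∀ d m → at-least d m ≡ exactly d m + at-least (suc d) m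
  at-least-split zero    zero    = refl
  at-least-split zero    (suc m) = refl
  at-least-split (suc d) zero    = refl
  at-least-split (suc d) (suc m) = at-least-split d m

  at-least-mono : ∀ d m → at-least d m ≤ at-least d (suc m)
  at-least-mono zero    m       = ≤-refl
  at-least-mono (suc d) zero    = z≤n
  at-least-mono (suc d) (suc m) = at-least-mono d m

  at-least-anti : ∀ {d e} m → d ≤ e → at-least e m ≤ at-least d m
  at-least-anti {e = e} m z≤n = 𝟙≤1 (e <ᵇ suc m)
  at-least-anti zero    (s≤s _)   = z≤n
  at-least-anti (suc m) (s≤s d≤e) = at-least-anti m d≤e

  at-least-false : ∀ {d m} → m < d → at-least d m ≡ 0
  at-least-false {suc d} {zero}  _         = refl
  at-least-false {suc d} {suc m} (s≤s m<d) = at-least-false m<d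

  at-least-true : ∀ {d m} → d ≤ m → at-least d m ≡ 1
  at-least-true z≤n       = refl
  at-least-true (s≤s d≤m) = at-least-true d≤m

  -- Binomial tails and their convexity

  tail layer : ℕ → ℕ → ℕ
  tail  n d = ∑ (subsets n) (λ S → at-least d ∣ S ∣)
  layer n d = ∑ (subsets n) (λ S → exactly d ∣ S ∣)

  tail-split : ∀ n d → tail n d ≡ layer n d + tail n (suc d)
  tail-split n d = trans (∑-cong (subsets n) (λ S → at-least-split d ∣ S ∣)) (∑-+ _ _ (subsets n))

  tail-anti : ∀ n {d e} → d ≤ e → tail n e ≤ tail n d
  tail-anti n d≤e = ∑-mono (subsets n) (λ S → at-least-anti ∣ S ∣ d≤e)

  tail-zero : ∀ n → tail n 0 ≡ 2 ^ n
  tail-zero n = trans (∑-subsets-const n 1) (*-identityʳ (2 ^ n))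

  tail-suc : ∀ n d → tail (suc n) (suc d) ≡ tail n d + tail n (suc d)
  tail-suc n d = ∑-subsets n (λ S → at-least (suc d) ∣ S ∣)

  layer-suc : ∀ n d → layer (suc n) (suc d) ≡ layer n d + layer n (suc d)
  layer-suc n d = ∑-subsets n (λ S → exactly (suc d) ∣ S ∣)

  tail-empty : ∀ {n d} → n < d → tail n d ≡ 0
  tail-empty {zero}  {suc d} _         = refl
  tail-empty {suc n} {suc d} (s≤s n<d) =
    trans (tail-suc n d) (cong₂ _+_ (tail-empty n<d) (tail-empty (m≤n⇒m≤1+n n<d)))

  layer-empty : ∀ {n d} → n < d → layer n d ≡ 0
  layer-empty {n} {d} n<d = m+n≡0⇒m≡0 (layer n d) (trans (sym (tail-split n d)) (tail-empty n<d))

  -- Complements of sets with at least `k` elements have fewer than `h`. The induction replaces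
  -- complementation by Pascal's rule, with the four tails paired so that the thresholds keep the
  -- sum `h + suc k`.
  tails-disjoint : ∀ n h k → n < h + k → tail n h + tail n k ≤ 2 ^ n
  tails-disjoint n zero k n<k = ≤-reflexive
    (trans (cong₂ _+_ (tail-zero n) (tail-empty n<k)) (+-identityʳ (2 ^ n)))
  tails-disjoint n (suc h) zero n<h = ≤-reflexive
    (cong₂ _+_ (tail-empty (subst (n <_) (+-identityʳ (suc h)) n<h)) (tail-zero n))
  tails-disjoint zero    (suc h) (suc k) _ = z≤n
  tails-disjoint (suc n) (suc h) (suc k) (s≤s n<) = begin
    tail (suc n) (suc h) + tail (suc n) (suc k)
      ≡⟨ cong₂ _+_ (tail-suc n h) (tail-suc n k) ⟩
    (tail n h + tail n (suc h)) + (tail n k + tail n (suc k))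
      ≡⟨ swap (tail n h) (tail n (suc h)) (tail n k) (tail n (suc k)) ⟩
    (tail n h + tail n (suc k)) + (tail n (suc h) + tail n k)
      ≤⟨ +-mono-≤ (tails-disjoint n h (suc k) n<)
           (tails-disjoint n (suc h) k (subst (n <_) (+-suc h k) n<)) ⟩
    2 ^ n + 2 ^ n
      ≡⟨ cong (2 ^ n +_) (sym (+-identityʳ (2 ^ n))) ⟩
    2 ^ suc n ∎
    where
    open ≤-Reasoning
    swap : ∀ a b c d → (a + b) + (c + d) ≡ (a + d) + (b + c)
    swap = solve-∀

  -- By `n ≤ k + d` the layer `k` is at least as far above the middle as `d` can be below it. In
  -- Pascal's rule the terms are compared crosswise, `k` with `suc d` and `suc k` with `d`, which
  -- needs `d < k`; hence the separate case of equality.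
  layer-decreasing : ∀ n {d k} → d ≤ k → n ≤ k + d → layer n k ≤ layer n d
  layer-decreasing n {d} {k} d≤k n≤ with m≤n⇒m<n∨m≡n d≤k
  ... | inj₂ refl = ≤-refl
  layer-decreasing zero    {d} {suc k} d≤k n≤ | inj₁ d<k = z≤n
  layer-decreasing (suc n) {zero} {suc k} d≤k (s≤s n≤) | inj₁ d<k = begin
    layer (suc n) (suc k)        ≡⟨ layer-suc n k ⟩
    layer n k + layer n (suc k)  ≡⟨ cong (layer n k +_) (layer-empty (s≤s n≤k)) ⟩
    layer n k + 0                ≡⟨ +-identityʳ (layer n k) ⟩
    layer n k                    ≤⟨ layer-decreasing n z≤n n≤ ⟩
    layer n 0                    ≤⟨ m≤n+m (layer n 0) _ ⟩
    ∑ (subsets n) (λ _ → 0) + layer n 0 ≡⟨ ∑-subsets n (λ S → exactly 0 ∣ S ∣) ⟨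
    layer (suc n) 0              ∎
    where
    open ≤-Reasoning
    n≤k : n ≤ k
    n≤k = subst (n ≤_) (+-identityʳ k) n≤
  layer-decreasing (suc n) {suc d} {suc k} d≤k (s≤s n≤) | inj₁ (s≤s d<k) = begin
    layer (suc n) (suc k)        ≡⟨ layer-suc n k ⟩
    layer n k + layer n (suc k)  ≤⟨ +-mono-≤ (layer-decreasing n d<k n≤)
                                      (layer-decreasing n (m≤n⇒m≤1+n (<⇒≤ d<k)) (subst (n ≤_) (+-suc k d) n≤)) ⟩
    layer n (suc d) + layer n d  ≡⟨ +-comm (layer n (suc d)) _ ⟩
    layer n d + layer n (suc d)  ≡⟨ layer-suc n d ⟨
    layer (suc n) (suc d)        ∎
    where open ≤-Reasoning

  module _ (n x : ℕ) (n≤2x : n ≤ x + x) where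

    -- The decrements of tail n are the layers, which decrease beyond n / 2.
    tail-convex : ∀ l j → tail n (l + x) + tail n (j + x) ≤ tail n x + tail n (l + (j + x))
    tail-convex zero    j = ≤-refl
    tail-convex (suc l) j = +-cancelˡ-≤ (layer n (l + x)) _ _ (begin
      layer n (l + x) + (tail n (suc l + x) + tail n (j + x))
        ≡⟨ +-assoc (layer n (l + x)) _ _ ⟨
      (layer n (l + x) + tail n (suc l + x)) + tail n (j + x)
        ≡⟨ cong (_+ tail n (j + x)) (tail-split n (l + x)) ⟨
      tail n (l + x) + tail n (j + x)
        ≤⟨ tail-convex l j ⟩
      tail n x + tail n (l + (j + x))
        ≡⟨ cong (tail n x +_) (tail-split n (l + (j + x))) ⟩
      tail n x + (layer n (l + (j + x)) + tail n (suc l + (j + x)))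
        ≤⟨ +-monoʳ-≤ (tail n x) (+-monoˡ-≤ _ (layer-decreasing n
             (+-monoʳ-≤ l (m≤n+m x j))
             (≤-trans n≤2x (+-mono-≤ (≤-trans (m≤n+m x j) (m≤n+m (j + x) l)) (m≤n+m x l))))) ⟩
      tail n x + (layer n (l + x) + tail n (suc l + (j + x)))
        ≡⟨ swap (tail n x) (layer n (l + x)) _ ⟩
      layer n (l + x) + (tail n x + tail n (suc l + (j + x))) ∎)
      where
      open ≤-Reasoning
      swap : ∀ a b c → a + (b + c) ≡ b + (a + c)
      swap = solve-∀

    -- A convex function drops most on the first of `Q` equal steps, hence there by at least the
    -- average of all `Q` drops.
    tail-chord : ∀ Q l → Q * tail n (l + x) + tail n x ≤ Q * tail n x + tail n (Q * l + x)
    tail-chord zero    l = ≤-refl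
    tail-chord (suc Q) l = begin
      (tail n (l + x) + Q * tail n (l + x)) + tail n x
        ≡⟨ +-assoc (tail n (l + x)) _ _ ⟩
      tail n (l + x) + (Q * tail n (l + x) + tail n x)
        ≤⟨ +-monoʳ-≤ (tail n (l + x)) (tail-chord Q l) ⟩
      tail n (l + x) + (Q * tail n x + tail n (Q * l + x))
        ≡⟨ swap (tail n (l + x)) (Q * tail n x) _ ⟩
      Q * tail n x + (tail n (l + x) + tail n (Q * l + x))
        ≤⟨ +-monoʳ-≤ (Q * tail n x) (tail-convex l (Q * l)) ⟩
      Q * tail n x + (tail n x + tail n (l + (Q * l + x)))
        ≡⟨ cong (λ k → Q * tail n x + (tail n x + tail n k)) (sym (+-assoc l (Q * l) x)) ⟩
      Q * tail n x + (tail n x + tail n (suc Q * l + x))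
        ≡⟨ swap′ (Q * tail n x) (tail n x) _ ⟩
      suc Q * tail n x + tail n (suc Q * l + x) ∎
      where
      open ≤-Reasoning
      swap : ∀ a b c → a + (b + c) ≡ b + (a + c)
      swap = solve-∀
      swap′ : ∀ a b c → a + (b + c) ≡ (b + a) + c
      swap′ = solve-∀

  -- Hamming distance to a fixed set

  dist : ∀ {n} → Subset n → Subset n → ℕ
  dist []      []      = 0
  dist (a ∷ S) (b ∷ N) = 𝟙 (a xor b) + dist S N

  ∣S∣+∣N∣ : ∀ {n} (S N : Subset n) → ∣ S ∣ + ∣ N ∣ ≡ dist S N + 2 * ∣ S ∩ N ∣
  ∣S∣+∣N∣ []          []          = refl
  ∣S∣+∣N∣ (true  ∷ S) (true  ∷ N) = trans (cong suc (+-suc ∣ S ∣ ∣ N ∣))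
    (trans (cong (λ k → suc (suc k)) (∣S∣+∣N∣ S N)) (shift (dist S N) ∣ S ∩ N ∣))
    where
    shift : ∀ a b → suc (suc (a + 2 * b)) ≡ a + 2 * suc b
    shift = solve-∀
  ∣S∣+∣N∣ (true  ∷ S) (false ∷ N) = cong suc (∣S∣+∣N∣ S N)
  ∣S∣+∣N∣ (false ∷ S) (true  ∷ N) = trans (+-suc ∣ S ∣ ∣ N ∣) (cong suc (∣S∣+∣N∣ S N))
  ∣S∣+∣N∣ (false ∷ S) (false ∷ N) = ∣S∣+∣N∣ S N

  -- Symmetric difference with `N` permutes the subsets and turns distance from `N` into size, so
  -- the distance is binomially distributed whatever `N` is.
  ∑-dist : ∀ {n} (N : Subset n) (f : ℕ → ℕ) → ∑ (subsets n) (λ S → f (dist S N)) ≡ ∑ (subsets n) (λ S → f ∣ S ∣)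
  ∑-dist []      f = refl
  ∑-dist {suc n} (true ∷ N) f = begin-equality
    ∑ (subsets (suc n)) (λ S → f (dist S (true ∷ N)))
      ≡⟨ ∑-subsets n (λ S → f (dist S (true ∷ N))) ⟩
    ∑ (subsets n) (λ S → f (dist S N)) + ∑ (subsets n) (λ S → f (suc (dist S N)))
      ≡⟨ cong₂ _+_ (∑-dist N f) (∑-dist N (λ k → f (suc k))) ⟩
    ∑ (subsets n) (λ S → f ∣ S ∣) + ∑ (subsets n) (λ S → f (suc ∣ S ∣))
      ≡⟨ +-comm (∑ (subsets n) (λ S → f ∣ S ∣)) _ ⟩
    ∑ (subsets n) (λ S → f (suc ∣ S ∣)) + ∑ (subsets n) (λ S → f ∣ S ∣)
      ≡⟨ ∑-subsets n (λ S → f ∣ S ∣) ⟨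
    ∑ (subsets (suc n)) (λ S → f ∣ S ∣) ∎
    where open ≤-Reasoning
  ∑-dist {suc n} (false ∷ N) f = trans (∑-subsets n (λ S → f (dist S (false ∷ N))))
    (trans (cong₂ _+_ (∑-dist N (λ k → f (suc k))) (∑-dist N f)) (sym (∑-subsets n (λ S → f ∣ S ∣))))

  -- Toggling v changes dist S N by one, upwards when v is added.
  ∑-containing : ∀ {n} (N : Subset n) (v : Fin n) → lookup N v ≡ false →
    (f : ℕ → ℕ) → (∀ k → f k ≤ f (suc k)) →
    2 * ∑ (subsets n) (λ S → 𝟙 (lookup S v) * f (dist S N)) ≤ ∑ (subsets n) (λ S → f (suc (dist S N)))
  ∑-containing {suc n} (false ∷ N) zero refl f mono = begin
    2 * ∑ (subsets (suc n)) (λ S → 𝟙 (lookup S zero) * f (dist S (false ∷ N)))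
      ≡⟨ cong (2 *_) (∑-subsets n (λ S → 𝟙 (lookup S zero) * f (dist S (false ∷ N)))) ⟩
    2 * (∑ (subsets n) (λ S → 1 * f (suc (dist S N))) + ∑ (subsets n) (λ _ → 0))
      ≡⟨ cong (2 *_) (cong₂ _+_ (∑-cong (subsets n) (λ S → *-identityˡ (f (suc (dist S N))))) (∑-zero (subsets n))) ⟩
    2 * (X + 0)
      ≡⟨ double X ⟩
    X + X
      ≤⟨ +-monoˡ-≤ X (∑-mono (subsets n) (λ S → mono (suc (dist S N)))) ⟩
    ∑ (subsets n) (λ S → f (suc (suc (dist S N)))) + X
      ≡⟨ ∑-subsets n (λ S → f (suc (dist S (false ∷ N)))) ⟨
    ∑ (subsets (suc n)) (λ S → f (suc (dist S (false ∷ N)))) ∎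
    where
    open ≤-Reasoning
    X = ∑ (subsets n) (λ S → f (suc (dist S N)))
    double : ∀ x → 2 * (x + 0) ≡ x + x
    double = solve-∀
  ∑-containing {suc n} (b ∷ N) (suc v) v∉N f mono = begin
    2 * ∑ (subsets (suc n)) (λ S → 𝟙 (lookup S (suc v)) * f (dist S (b ∷ N)))
      ≡⟨ cong (2 *_) (∑-subsets n (λ S → 𝟙 (lookup S (suc v)) * f (dist S (b ∷ N)))) ⟩
    2 * (inner true + inner false)
      ≡⟨ *-distribˡ-+ 2 (inner true) (inner false) ⟩
    2 * inner true + 2 * inner false
      ≤⟨ +-mono-≤ (step true) (step false) ⟩
    outer true + outer false
      ≡⟨ ∑-subsets n (λ S → f (suc (dist S (b ∷ N)))) ⟨
    ∑ (subsets (suc n)) (λ S → f (suc (dist S (b ∷ N)))) ∎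
    where
    open ≤-Reasoning
    inner outer : Bool → ℕ
    inner a = ∑ (subsets n) (λ S → 𝟙 (lookup S v) * f (dist (a ∷ S) (b ∷ N)))
    outer a = ∑ (subsets n) (λ S → f (suc (dist (a ∷ S) (b ∷ N))))
    step : ∀ a → 2 * inner a ≤ outer a
    step a with a xor b
    ... | true  = ∑-containing N v v∉N (λ k → f (suc k)) (λ k → mono (suc k))
    ... | false = ∑-containing N v v∉N f mono

  -- Moments of the deviation

  -- The deviation of ∣ S ∩ T ∣ from ∣ T ∣ / 2, doubled.
  dev : ∀ {n} → Subset n → Subset n → ℕ
  dev T S = ∣ ∣ S ∩ T ∣ - ∣ ∁ S ∩ T ∣ ∣

  ∣S∩T∣+∣∁S∩T∣ : ∀ {n} (S T : Subset n) → ∣ S ∩ T ∣ + ∣ ∁ S ∩ T ∣ ≡ ∣ T ∣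
  ∣S∩T∣+∣∁S∩T∣ []          []          = refl
  ∣S∩T∣+∣∁S∩T∣ (true  ∷ S) (true  ∷ T) = cong suc (∣S∩T∣+∣∁S∩T∣ S T)
  ∣S∩T∣+∣∁S∩T∣ (false ∷ S) (true  ∷ T) = trans (+-suc ∣ S ∩ T ∣ _) (cong suc (∣S∩T∣+∣∁S∩T∣ S T))
  ∣S∩T∣+∣∁S∩T∣ (true  ∷ S) (false ∷ T) = ∣S∩T∣+∣∁S∩T∣ S T
  ∣S∩T∣+∣∁S∩T∣ (false ∷ S) (false ∷ T) = ∣S∩T∣+∣∁S∩T∣ S T

  infix 8 _² _⁴

  _² _⁴ : ℕ → ℕ
  x ² = x * x
  x ⁴ = (x * x) * (x * x)

  -- Up to sign and order the two differences are `d + 1` and `d - 1`, so the odd powers of `d`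
  -- cancel; likewise for fourth powers.
  second-difference : ∀ a b → let d = ∣ a - b ∣ in
    ∣ suc a - b ∣ ² + ∣ a - suc b ∣ ² ≡ 2 * d ² + 2
  second-difference zero    zero    = refl
  second-difference zero    (suc b) = lemma b
    where
    lemma : ∀ b → (b * b) + ((2 + b) * (2 + b)) ≡ 2 * (suc b * suc b) + 2
    lemma = solve-∀
  second-difference (suc a) zero    rewrite ∣-∣-identityʳ a = lemma a
    where
    lemma : ∀ b → ((2 + b) * (2 + b)) + (b * b) ≡ 2 * (suc b * suc b) + 2
    lemma = solve-∀
  second-difference (suc a) (suc b) = second-difference a b

  fourth-difference : ∀ a b → let d = ∣ a - b ∣ in
    ∣ suc a - b ∣ ⁴ + ∣ a - suc b ∣ ⁴ ≡ 2 * d ⁴ + (12 * d ² + 2)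
  fourth-difference zero    zero    = refl
  fourth-difference zero    (suc b) = lemma b
    where
    lemma : ∀ b → ((b * b) * (b * b)) + (((2 + b) * (2 + b)) * ((2 + b) * (2 + b))) ≡ 2 * ((suc b * suc b) * (suc b * suc b)) + (12 * (suc b * suc b) + 2)
    lemma = solve-∀
  fourth-difference (suc a) zero    rewrite ∣-∣-identityʳ a = lemma a
    where
    lemma : ∀ b → (((2 + b) * (2 + b)) * ((2 + b) * (2 + b))) + ((b * b) * (b * b)) ≡ 2 * ((suc b * suc b) * (suc b * suc b)) + (12 * (suc b * suc b) + 2)
    lemma = solve-∀
  fourth-difference (suc a) (suc b) = fourth-difference a b

  moment : ∀ {n} → (ℕ → ℕ) → Subset n → ℕ
  moment {n} f T = ∑ (subsets n) (λ S → f (dev T S))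

  moment-outside : ∀ {n} f (T : Subset n) → moment f (false ∷ T) ≡ 2 * moment f T
  moment-outside {n} f T = trans (∑-subsets n (λ S → f (dev (false ∷ T) S)))
    (cong (moment f T +_) (sym (+-identityʳ (moment f T))))

  moment-inside : ∀ {n} f (T : Subset n) → moment f (true ∷ T) ≡
    ∑ (subsets n) (λ S → f ∣ suc ∣ S ∩ T ∣ - ∣ ∁ S ∩ T ∣ ∣ + f ∣ ∣ S ∩ T ∣ - suc ∣ ∁ S ∩ T ∣ ∣)
  moment-inside {n} f T = trans (∑-subsets n (λ S → f (dev (true ∷ T) S))) (sym (∑-+ _ _ (subsets n)))

  -- Each element of `T` is an independent step of a random walk by plus or minus one and adds 1 to
  -- the mean square; elements outside `T` add nothing.
  second-moment : ∀ {n} (T : Subset n) → moment _² T ≤ n * 2 ^ n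
  second-moment []          = z≤n
  second-moment {suc n} (false ∷ T) = begin
    moment _² (false ∷ T)   ≡⟨ moment-outside _² T ⟩
    2 * moment _² T         ≤⟨ *-monoʳ-≤ 2 (second-moment T) ⟩
    2 * (n * 2 ^ n)        ≤⟨ m≤m+n _ (2 * 2 ^ n) ⟩
    2 * (n * 2 ^ n) + 2 * 2 ^ n ≡⟨ collect n (2 ^ n) ⟩
    suc n * 2 ^ suc n      ∎
    where
    open ≤-Reasoning
    collect : ∀ n p → 2 * (n * p) + 2 * p ≡ suc n * (2 * p)
    collect = solve-∀
  second-moment {suc n} (true ∷ T) = begin
    moment _² (true ∷ T)
      ≡⟨ moment-inside _² T ⟩
    ∑ (subsets n) (λ S → ∣ suc ∣ S ∩ T ∣ - ∣ ∁ S ∩ T ∣ ∣ ² + ∣ ∣ S ∩ T ∣ - suc ∣ ∁ S ∩ T ∣ ∣ ²)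
      ≡⟨ ∑-cong (subsets n) (λ S → second-difference ∣ S ∩ T ∣ ∣ ∁ S ∩ T ∣) ⟩
    ∑ (subsets n) (λ S → 2 * dev T S ² + 2)
      ≡⟨ trans (∑-+ _ _ (subsets n)) (cong₂ _+_ (∑-*ˡ 2 _ (subsets n)) (∑-subsets-const n 2)) ⟩
    2 * moment _² T + 2 ^ n * 2
      ≤⟨ +-monoˡ-≤ (2 ^ n * 2) (*-monoʳ-≤ 2 (second-moment T)) ⟩
    2 * (n * 2 ^ n) + 2 ^ n * 2
      ≡⟨ collect n (2 ^ n) ⟩
    suc n * 2 ^ suc n ∎
    where
    open ≤-Reasoning
    collect : ∀ n p → 2 * (n * p) + p * 2 ≡ suc n * (2 * p)
    collect = solve-∀

  -- A step adds six times the mean square plus 1 to the mean fourth power. This is at most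
  -- `6n + 1`, and `3n²` grows by `6n + 3`.
  fourth-moment : ∀ {n} (T : Subset n) → moment _⁴ T ≤ 3 * n ² * 2 ^ n
  fourth-moment []                  = z≤n
  fourth-moment {suc n} (false ∷ T) = begin
    moment _⁴ (false ∷ T)             ≡⟨ moment-outside _⁴ T ⟩
    2 * moment _⁴ T                   ≤⟨ *-monoʳ-≤ 2 (fourth-moment T) ⟩
    2 * (3 * n ² * 2 ^ n)          ≤⟨ m≤m+n _ ((2 * n + 1) * (6 * 2 ^ n)) ⟩
    2 * (3 * n ² * 2 ^ n) + (2 * n + 1) * (6 * 2 ^ n) ≡⟨ collect n (2 ^ n) ⟩
    3 * suc n ² * 2 ^ suc n        ∎
    where
    open ≤-Reasoning
    collect : ∀ n p → 2 * (3 * (n * n) * p) + (2 * n + 1) * (6 * p) ≡ 3 * (suc n * suc n) * (2 * p)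
    collect = solve-∀
  fourth-moment {suc n} (true ∷ T) = begin
    moment _⁴ (true ∷ T)
      ≡⟨ moment-inside _⁴ T ⟩
    ∑ (subsets n) (λ S → ∣ suc ∣ S ∩ T ∣ - ∣ ∁ S ∩ T ∣ ∣ ⁴ + ∣ ∣ S ∩ T ∣ - suc ∣ ∁ S ∩ T ∣ ∣ ⁴)
      ≡⟨ ∑-cong (subsets n) (λ S → fourth-difference ∣ S ∩ T ∣ ∣ ∁ S ∩ T ∣) ⟩
    ∑ (subsets n) (λ S → 2 * dev T S ⁴ + (12 * dev T S ² + 2))
      ≡⟨ trans (∑-+ _ _ (subsets n)) (cong₂ _+_ (∑-*ˡ 2 _ (subsets n))
           (trans (∑-+ _ _ (subsets n)) (cong₂ _+_ (∑-*ˡ 12 _ (subsets n)) (∑-subsets-const n 2)))) ⟩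
    2 * moment _⁴ T + (12 * moment _² T + 2 ^ n * 2)
      ≤⟨ +-mono-≤ (*-monoʳ-≤ 2 (fourth-moment T)) (+-monoˡ-≤ (2 ^ n * 2) (*-monoʳ-≤ 12 (second-moment T))) ⟩
    2 * (3 * n ² * 2 ^ n) + (12 * (n * 2 ^ n) + 2 ^ n * 2)
      ≤⟨ m≤m+n _ (4 * 2 ^ n) ⟩
    2 * (3 * n ² * 2 ^ n) + (12 * (n * 2 ^ n) + 2 ^ n * 2) + 4 * 2 ^ n
      ≡⟨ collect n (2 ^ n) ⟩
    3 * suc n ² * 2 ^ suc n ∎
    where
    open ≤-Reasoning
    collect : ∀ n p → 2 * (3 * (n * n) * p) + (12 * (n * p) + p * 2) + 4 * p ≡ 3 * (suc n * suc n) * (2 * p)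
    collect = solve-∀

  m⁴-mono : ∀ {a b} → a ≤ b → a ⁴ ≤ b ⁴
  m⁴-mono a≤b = *-mono-≤ (*-mono-≤ a≤b a≤b) (*-mono-≤ a≤b a≤b)

  ⁴-* : ∀ a b → (a * b) ⁴ ≡ a ⁴ * b ⁴
  ⁴-* = lemma
    where
    lemma : ∀ a b → ((a * b) * (a * b)) * ((a * b) * (a * b)) ≡ ((a * a) * (a * a)) * ((b * b) * (b * b))
    lemma = solve-∀

  dev-⊤ : ∀ {n} (S : Subset n) → n ≤ ∣ S ∣ + ∣ S ∣ + dev ⊤ S × ∣ S ∣ + ∣ S ∣ ≤ n + dev ⊤ S
  dev-⊤ {n} S = lower , upper
    where
    open ≤-Reasoning
    a b : ℕ
    a = ∣ S ∩ ⊤ ∣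
    b = ∣ ∁ S ∩ ⊤ ∣
    ∣S∣≡a : ∣ S ∣ ≡ a
    ∣S∣≡a = cong ∣_∣ (sym (∩-identityʳ S))
    n≡a+b : n ≡ a + b
    n≡a+b = trans (sym (∣⊤∣≡n n)) (sym (∣S∩T∣+∣∁S∩T∣ S ⊤))
    lower : n ≤ ∣ S ∣ + ∣ S ∣ + dev ⊤ S
    lower = begin
      n                          ≡⟨ n≡a+b ⟩
      a + b                      ≤⟨ +-monoʳ-≤ a (m≤n+∣n-m∣ b a) ⟩
      a + (a + ∣ a - b ∣)        ≡⟨ +-assoc a a _ ⟨
      a + a + ∣ a - b ∣          ≡⟨ cong₂ (λ x y → x + y + ∣ a - b ∣) ∣S∣≡a ∣S∣≡a ⟨
      ∣ S ∣ + ∣ S ∣ + dev ⊤ S    ∎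
    upper : ∣ S ∣ + ∣ S ∣ ≤ n + dev ⊤ S
    upper = begin
      ∣ S ∣ + ∣ S ∣              ≡⟨ cong₂ _+_ ∣S∣≡a ∣S∣≡a ⟩
      a + a                      ≤⟨ +-monoʳ-≤ a (m≤n+∣m-n∣ a b) ⟩
      a + (b + ∣ a - b ∣)        ≡⟨ +-assoc a b _ ⟨
      a + b + ∣ a - b ∣          ≡⟨ cong (_+ ∣ a - b ∣) n≡a+b ⟨
      n + dev ⊤ S                ∎

  -- Markov's inequality for the fourth moment: such sets have `dev ⊤ S` at least `2r`, and
  -- `(2r)⁴ = 16r⁴` is set against `3n² ≤ 3r⁴`.
  tail-far : ∀ {n h r} → n ≤ h + h → n ≤ r * r → NonZero r → 16 * tail n (r + h) ≤ 3 * 2 ^ n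
  tail-far {n} {h} {r} n≤2h n≤r² r≢0 = *-cancelʳ-≤ _ _ (r ⁴) {{r⁴≢0}} (begin
    16 * tail n (r + h) * r ⁴
      ≡⟨ arrange (tail n (r + h)) r ⟩
    (r + r) ⁴ * tail n (r + h)
      ≡⟨ ∑-*ˡ ((r + r) ⁴) (λ S → at-least (r + h) ∣ S ∣) (subsets n) ⟨
    ∑ (subsets n) (λ S → (r + r) ⁴ * at-least (r + h) ∣ S ∣)
      ≤⟨ ∑-mono (subsets n) pointwise ⟩
    moment _⁴ (⊤ {n})
      ≤⟨ fourth-moment (⊤ {n}) ⟩
    3 * n ² * 2 ^ n
      ≤⟨ *-monoˡ-≤ (2 ^ n) (*-monoʳ-≤ 3 (*-mono-≤ n≤r² n≤r²)) ⟩
    3 * r ⁴ * 2 ^ n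
      ≡⟨ swap (r ⁴) (2 ^ n) ⟩
    3 * 2 ^ n * r ⁴ ∎)
    where
    open ≤-Reasoning
    r⁴≢0 : NonZero (r ⁴)
    r⁴≢0 = m*n≢0 (r * r) (r * r) {{m*n≢0 r r {{r≢0}} {{r≢0}}}} {{m*n≢0 r r {{r≢0}} {{r≢0}}}}
    arrange : ∀ t r → 16 * t * ((r * r) * (r * r)) ≡ (((r + r) * (r + r)) * ((r + r) * (r + r))) * t
    arrange = solve-∀
    swap : ∀ a p → 3 * a * p ≡ 3 * p * a
    swap = solve-∀
    far : ∀ (S : Subset n) → r + h ≤ ∣ S ∣ → r + r ≤ dev ⊤ S
    far S r+h≤ = +-cancelˡ-≤ n _ _ (begin
      n + (r + r)        ≤⟨ +-monoˡ-≤ (r + r) n≤2h ⟩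
      h + h + (r + r)    ≡⟨ interchange h r ⟩
      (r + h) + (r + h)  ≤⟨ +-mono-≤ r+h≤ r+h≤ ⟩
      ∣ S ∣ + ∣ S ∣      ≤⟨ proj₂ (dev-⊤ S) ⟩
      n + dev ⊤ S        ∎)
      where
      interchange : ∀ h r → h + h + (r + r) ≡ (r + h) + (r + h)
      interchange = solve-∀
    pointwise : ∀ (S : Subset n) → (r + r) ⁴ * at-least (r + h) ∣ S ∣ ≤ dev ⊤ S ⁴
    pointwise S with r + h ≤? ∣ S ∣
    ... | yes r+h≤ = begin
      (r + r) ⁴ * at-least (r + h) ∣ S ∣  ≤⟨ *-monoʳ-≤ ((r + r) ⁴) (𝟙≤1 (r + h <ᵇ suc ∣ S ∣)) ⟩
      (r + r) ⁴ * 1                       ≡⟨ *-identityʳ _ ⟩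
      (r + r) ⁴                           ≤⟨ m⁴-mono (far S r+h≤) ⟩
      dev ⊤ S ⁴                           ∎
    ... | no  r+h≰ = begin
      (r + r) ⁴ * at-least (r + h) ∣ S ∣  ≡⟨ cong ((r + r) ⁴ *_) (at-least-false (≰⇒> r+h≰)) ⟩
      (r + r) ⁴ * 0                       ≡⟨ *-zeroʳ ((r + r) ⁴) ⟩
      0                                   ≤⟨ z≤n ⟩
      dev ⊤ S ⁴                           ∎

  -- The chord through h and h + Q l bounds the convex tail at h + l: the tail is
  -- at most a half at h and at most a quarter at h + Q l, which is √ n away.
  tail-near-half : ∀ {n h l} q → let Q = suc q in n < h + h → n ≤ (Q * l) * (Q * l) → NonZero l →
    4 * Q * tail n (l + h) + 2 ^ n ≤ 2 * Q * 2 ^ n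
  tail-near-half {n} {h} {l} q n<2h n≤ l≢0 = begin
    4 * Q * X + P             ≡⟨ cong (_+ P) (*-assoc 4 Q X) ⟩
    4 * (Q * X) + P           ≤⟨ +-monoˡ-≤ P (*-monoʳ-≤ 4 QX≤) ⟩
    4 * (q * H + Y) + P       ≡⟨ arrange q H Y P ⟩
    2 * q * (H + H) + 4 * Y + P ≤⟨ +-monoˡ-≤ P (+-mono-≤ (*-monoʳ-≤ (2 * q) (tails-disjoint n h h n<2h)) 4Y≤P) ⟩
    2 * q * P + P + P         ≡⟨ collect q P ⟩
    2 * Q * P                 ∎
    where
    open ≤-Reasoning
    Q = suc q
    P = 2 ^ n
    X = tail n (l + h)
    H = tail n h
    Y = tail n (Q * l + h)
    QX≤ : Q * X ≤ q * H + Y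
    QX≤ = +-cancelʳ-≤ H _ _ (begin
      Q * X + H        ≤⟨ tail-chord n h (<⇒≤ n<2h) Q l ⟩
      H + q * H + Y    ≡⟨ swap H (q * H) Y ⟩
      q * H + Y + H    ∎)
      where
      swap : ∀ a b c → a + b + c ≡ b + c + a
      swap = solve-∀
    4Y≤P : 4 * Y ≤ P
    4Y≤P = *-cancelˡ-≤ 4 (begin
      4 * (4 * Y)  ≡⟨ *-assoc 4 4 Y ⟨
      16 * Y       ≤⟨ tail-far (<⇒≤ n<2h) n≤ (m*n≢0 Q l {{_}} {{l≢0}}) ⟩
      3 * P        ≤⟨ *-monoˡ-≤ P (n≤1+n 3) ⟩
      4 * P        ∎)
    arrange : ∀ q h y p → 4 * (q * h + y) + p ≡ 2 * q * (h + h) + 4 * y + p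
    arrange = solve-∀
    collect : ∀ q p → 2 * q * p + p + p ≡ 2 * suc q * p
    collect = solve-∀

  -- Counting cyclic subsets

  ∑-lookup : ∀ {n} (S : Subset n) → ∑ (allFin n) (λ v → 𝟙 (lookup S v)) ≡ ∣ S ∣
  ∑-lookup [] = refl
  ∑-lookup {suc n} (b ∷ S) = trans
    (cong (𝟙 b +_) (trans (cong (λ l → ∑ l (λ v → 𝟙 (lookup (b ∷ S) v))) (sym (map-tabulate (λ v → v) suc)))
      (trans (∑-map (λ v → 𝟙 (lookup (b ∷ S) v)) suc (allFin n)) (∑-lookup S))))
    (first b)
    where
    first : ∀ b → 𝟙 b + ∣ S ∣ ≡ ∣ b ∷ S ∣
    first true  = refl
    first false = refl

  elements : ∀ {n} → Subset n → List (Fin n)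
  elements {n} S = filter (λ v → lookup S v Bool.≟ true) (allFin n)

  𝟙-≟ : ∀ b → 𝟙 (does (b Bool.≟ true)) ≡ 𝟙 b
  𝟙-≟ true  = refl
  𝟙-≟ false = refl

  length-elements : ∀ {n} (S : Subset n) → length (elements S) ≡ ∣ S ∣
  length-elements {n} S = trans (length-filter (λ v → lookup S v Bool.≟ true) (allFin n))
    (trans (∑-cong (allFin n) (λ v → 𝟙-≟ (lookup S v))) (∑-lookup S))

  ∑-elements : ∀ {n} (S : Subset n) (f : Fin n → ℕ) →
    ∑ (elements S) f ≡ ∑ (allFin n) (λ v → 𝟙 (lookup S v) * f v)
  ∑-elements {n} S f = trans (∑-filter (λ v → lookup S v Bool.≟ true) f (allFin n))
    (∑-cong (allFin n) (λ v → cong (_* f v) (𝟙-≟ (lookup S v))))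

  module _ {n : ℕ} (G : Graph n) where

    open Graph G

    adj : Fin n → Fin n → Bool
    adj u v = does (adj? u v)

    adj-sym : ∀ u v → adj u v ≡ adj v u
    adj-sym u v = does-⇔ (mk⇔ symm symm) (adj? u v) (adj? v u)

    adj-irrefl : ∀ u → adj u u ≡ false
    adj-irrefl u = dec-false (adj? u u) (irrefl refl)

    N : Fin n → Subset n
    N = neighbours G

    cnt-adj : ∀ S u → cnt (adj u) (elements S) ≡ ∣ S ∩ N u ∣
    cnt-adj S u = trans (∑-elements S (λ v → 𝟙 (adj u v))) (trans (∑-cong (allFin n) pointwise) (∑-lookup (S ∩ N u)))
      where
      pointwise : ∀ v → 𝟙 (lookup S v) * 𝟙 (adj u v) ≡ 𝟙 (lookup (S ∩ N u) v)
      pointwise v = trans (sym (𝟙-∧ (lookup S v) (adj u v)))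
        (cong 𝟙 (trans (cong (lookup S v ∧_) (sym (lookup∘tabulate (adj u) v)))
          (sym (lookup-zipWith _∧_ v S (N u)))))

    rich : Subset n → Fin n → Bool
    rich S v = does (∣ S ∣ ≤? 2 * ∣ S ∩ N v ∣)

    poor-count : Subset n → ℕ
    poor-count S = ∑ (allFin n) (λ v → 𝟙 (lookup S v) * 𝟙 (not (rich S v)))

    defect-free : ∀ l → defects adj l ≡ 0 → Linked Adj l
    defect-free []          _ = []
    defect-free (x ∷ [])    _ = [-]
    defect-free (x ∷ y ∷ l) d = edge (adj? x y) (m+n≡0⇒m≡0 _ d)
      ∷ defect-free (y ∷ l) (m+n≡0⇒n≡0 (𝟙 (not (adj x y))) d)
      where
      edge : (xy? : Dec (Adj x y)) → 𝟙 (not (does xy?)) ≡ 0 → Adj x y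
      edge (yes xy) _ = xy

    rich⇒half : ∀ S u → rich S u ≡ true → ∣ S ∣ ≤ 2 * ∣ S ∩ N u ∣
    rich⇒half S u = witness (∣ S ∣ ≤? 2 * ∣ S ∩ N u ∣)
      where
      witness : ∀ {A : Set} (a? : Dec A) → does a? ≡ true → A
      witness (yes a) _ = a

    cycle-of-elements : ∀ S {y ys} → 3 ≤ ∣ S ∣ → y ∷ ys ↭ elements S → defects adj (closed y ys) ≡ 0 → Cyclic G S
    cycle-of-elements S {y} {ys} 3≤ perm no-defect = y ∷ ys
      , (subst (3 ≤_) (sym (trans (↭-length perm) (length-elements S))) 3≤
        , Permutation.Unique-resp-↭ (setoid (Fin n)) (↭⇒↭ₛ (↭-sym perm)) (filter⁺ in? (allFin⁺ n))
        , defect-free (closed y ys) no-defect)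
      , λ v → mk⇔
          (λ v∈S → ∈-resp-↭ (↭-sym perm) (∈-filter⁺ in? (∈-allFin v) ([]=⇒lookup v∈S)))
          (λ v∈ys → lookup⇒[]= v S (proj₂ (∈-filter⁻ in? {xs = allFin n} (∈-resp-↭ perm v∈ys))))
      where
      in? : (v : Fin n) → Dec (lookup S v ≡ true)
      in? v = lookup S v Bool.≟ true

    cyclic-criterion : ∀ S → 3 ≤ ∣ S ∣ → 2 * poor-count S ≤ ∣ S ∣ →
      (∀ v → poor-count S < ∣ S ∩ N v ∣) → Cyclic G S
    cyclic-criterion S 3≤ majority few =
      let _ , _ , eq             = nonempty (elements S) (subst (3 ≤_) (sym (length-elements S)) 3≤)
          _ , _ , perm , no-defect = hamiltonian adj adj-sym adj-irrefl (rich S) (elements S)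
                                       half few′ majority′ eq
      in cycle-of-elements S 3≤ perm no-defect
      where
      nonempty : ∀ (l : List (Fin n)) → 3 ≤ length l → ∃ λ x → ∃ λ xs → l ≡ x ∷ xs
      nonempty (x ∷ xs) _ = x , xs , refl
      exceptions : cnt (λ y → not (rich S y)) (elements S) ≡ poor-count S
      exceptions = ∑-elements S (λ y → 𝟙 (not (rich S y)))
      half : ∀ u → u ∈ elements S → rich S u ≡ true → length (elements S) ≤ 2 * cnt (adj u) (elements S)
      half u _ r = subst₂ (λ m d → m ≤ 2 * d) (sym (length-elements S)) (sym (cnt-adj S u)) (rich⇒half S u r)
      few′ : ∀ u → u ∈ elements S → cnt (λ y → not (rich S y)) (elements S) < cnt (adj u) (elements S)
      few′ u _ = subst₂ _<_ (sym exceptions) (sym (cnt-adj S u)) (few u)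
      majority′ : 2 * cnt (λ y → not (rich S y)) (elements S) ≤ length (elements S)
      majority′ = subst₂ (λ b m → 2 * b ≤ m) (sym exceptions) (sym (length-elements S)) majority

    v∉N : ∀ v → lookup (N v) v ≡ false
    v∉N v = trans (lookup∘tabulate (adj v) v) (adj-irrefl v)

    poor⇒dist : ∀ S v → 𝟙 (not (rich S v)) ≤ at-least (suc (degree G v)) (dist S (N v))
    poor⇒dist S v = by-cases (∣ S ∣ ≤? 2 * ∣ S ∩ N v ∣)
      where
      open ≤-Reasoning
      by-cases : (r? : Dec (∣ S ∣ ≤ 2 * ∣ S ∩ N v ∣)) →
        𝟙 (not (does r?)) ≤ at-least (suc (degree G v)) (dist S (N v))
      by-cases (yes _)  = z≤n
      by-cases (no big) = ≤-reflexive (sym (at-least-true (+-cancelʳ-< ∣ S ∣ (degree G v) (dist S (N v)) (begin-strict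
        degree G v + ∣ S ∣                ≡⟨ +-comm (degree G v) ∣ S ∣ ⟩
        ∣ S ∣ + degree G v                ≡⟨ ∣S∣+∣N∣ S (N v) ⟩
        dist S (N v) + 2 * ∣ S ∩ N v ∣    <⟨ +-monoʳ-< (dist S (N v)) (≰⇒> big) ⟩
        dist S (N v) + ∣ S ∣              ∎))))

    ∑-poor : ∀ {d} → (∀ v → d ≤ degree G v) → 2 * ∑ (subsets n) poor-count ≤ n * tail n d
    ∑-poor {d} d≤ = begin
      2 * ∑ (subsets n) poor-count
        ≡⟨ cong (2 *_) (∑-swap (λ S v → 𝟙 (lookup S v) * 𝟙 (not (rich S v))) (subsets n) (allFin n)) ⟩
      2 * ∑ (allFin n) (λ v → ∑ (subsets n) (λ S → 𝟙 (lookup S v) * 𝟙 (not (rich S v))))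
        ≡⟨ ∑-*ˡ 2 _ (allFin n) ⟨
      ∑ (allFin n) (λ v → 2 * ∑ (subsets n) (λ S → 𝟙 (lookup S v) * 𝟙 (not (rich S v))))
        ≤⟨ ∑-mono (allFin n) one ⟩
      ∑ (allFin n) (λ _ → tail n d)
        ≡⟨ trans (∑-const (tail n d) (allFin n)) (cong (_* tail n d) (length-tabulate (λ (v : Fin n) → v))) ⟩
      n * tail n d ∎
      where
      open ≤-Reasoning
      one : ∀ v → 2 * ∑ (subsets n) (λ S → 𝟙 (lookup S v) * 𝟙 (not (rich S v))) ≤ tail n d
      one v = begin
        2 * ∑ (subsets n) (λ S → 𝟙 (lookup S v) * 𝟙 (not (rich S v)))
          ≤⟨ *-monoʳ-≤ 2 (∑-mono (subsets n) (λ S → *-monoʳ-≤ (𝟙 (lookup S v)) (poor⇒dist S v))) ⟩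
        2 * ∑ (subsets n) (λ S → 𝟙 (lookup S v) * at-least (suc (degree G v)) (dist S (N v)))
          ≤⟨ ∑-containing (N v) v (v∉N v) (at-least (suc (degree G v))) (at-least-mono (suc (degree G v))) ⟩
        -- Poverty is a strict inequality and yields distance `suc (degree G v)`. The extra one
        -- makes up for the shift in `∑-containing`, since `at-least` cancels a `suc` on both sides.
        ∑ (subsets n) (λ S → at-least (degree G v) (dist S (N v)))
          ≡⟨ ∑-dist (N v) (at-least (degree G v)) ⟩
        tail n (degree G v)
          ≤⟨ tail-anti n (d≤ v) ⟩
        tail n d ∎

    𝟙-cyclic : Subset n → ℕ
    𝟙-cyclic S = 𝟙 (does (cyclic? G S))

    Cyc≡∑ : Cyc G ≡ ∑ (subsets n) 𝟙-cyclic
    Cyc≡∑ = length-filter (cyclic? G) (subsets n)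

  ∑-term : ∀ {n} (f : Fin n → ℕ) v → f v ≤ ∑ (allFin n) f
  ∑-term f v = go (∈-allFin v)
    where
    go : ∀ {xs} → v ∈ xs → f v ≤ ∑ xs f
    go {x ∷ xs} (here refl) = m≤m+n (f x) (∑ xs f)
    go {x ∷ xs} (there v∈)  = ≤-trans (go v∈) (m≤n+m (∑ xs f) (f x))

  -- Markov's inequality for the exceptional sets

  module _ {n : ℕ} (G : Graph n) (q : ℕ) where

    private
      -- As `D = 4Q - 1`, the cutoff `D n / (16 Q)` for the number of poor vertices equals
      -- `(1/4 - 1/(16Q)) n`. It lies halfway between `n/4` and the bound `(1/4 - 1/(8Q)) n` on the
      -- mean.
      Q D : ℕ
      Q = suc q
      D = 4 * q + 3
      D+1≡4Q : D + 1 ≡ 4 * Q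
      D+1≡4Q = lemma q
        where
        lemma : ∀ q → 4 * q + 3 + 1 ≡ 4 * suc q
        lemma = solve-∀

    -- A sum rather than a maximum, so that its mean is a sum of fourth moments; one large term
    -- suffices to make it large. The term for `⊤` controls the size of `S`.
    deviation : Subset n → ℕ
    deviation S = dev ⊤ S ⁴ + ∑ (allFin n) (λ v → dev (N G v) S ⁴)

    ∑-deviation : ∑ (subsets n) deviation ≤ suc n * (3 * n ² * 2 ^ n)
    ∑-deviation = begin
      ∑ (subsets n) deviation
        ≡⟨ ∑-+ (λ S → dev ⊤ S ⁴) _ (subsets n) ⟩
      moment _⁴ (⊤ {n}) + ∑ (subsets n) (λ S → ∑ (allFin n) (λ v → dev (N G v) S ⁴))
        ≡⟨ cong (moment _⁴ (⊤ {n}) +_) (∑-swap (λ S v → dev (N G v) S ⁴) (subsets n) (allFin n)) ⟩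
      moment _⁴ (⊤ {n}) + ∑ (allFin n) (λ v → moment _⁴ (N G v))
        ≤⟨ +-mono-≤ (fourth-moment (⊤ {n})) (∑-mono (allFin n) (λ v → fourth-moment (N G v))) ⟩
      M + ∑ (allFin n) (λ _ → M)
        ≡⟨ cong (M +_) (trans (∑-const M (allFin n)) (cong (_* M) (length-tabulate (λ (v : Fin n) → v)))) ⟩
      suc n * M ∎
      where
      open ≤-Reasoning
      M = 3 * n ² * 2 ^ n

    module _ (8≤n : 8 ≤ n) (n≤2deg : ∀ v → n ≤ degree G v + degree G v) where

      -- `N v` has at least `n/2` elements. If at most `(1/4 - 1/(16Q)) n` of them are in `S`, then
      -- the parts inside and outside `S` differ by at least `n/(8Q)`.
      dev-N : ∀ S v → 16 * Q * ∣ S ∩ N G v ∣ ≤ D * n → n ≤ 8 * Q * dev (N G v) S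
      dev-N S v small = *-cancelˡ-≤ 2 (+-cancelʳ-≤ (2 * (D * n)) _ _ (begin
        2 * n + 2 * (D * n)
          ≡⟨ trans (collect n D) (trans (cong (λ k → 2 * k * n) D+1≡4Q) (expand Q n)) ⟩
        8 * Q * n
          ≤⟨ *-monoʳ-≤ (8 * Q) (n≤2deg v) ⟩
        8 * Q * (degree G v + degree G v)
          ≡⟨ cong (λ t → 8 * Q * (t + t)) (sym (∣S∩T∣+∣∁S∩T∣ S (N G v))) ⟩
        8 * Q * ((a + b) + (a + b))
          ≤⟨ *-monoʳ-≤ (8 * Q) (+-mono-≤ (+-monoʳ-≤ a b≤) (+-monoʳ-≤ a b≤)) ⟩
        8 * Q * ((a + (a + s)) + (a + (a + s)))
          ≡⟨ arrange Q a s ⟩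
        2 * (8 * Q * s) + 2 * (16 * Q * a)
          ≤⟨ +-monoʳ-≤ (2 * (8 * Q * s)) (*-monoʳ-≤ 2 small) ⟩
        2 * (8 * Q * s) + 2 * (D * n) ∎))
        where
        open ≤-Reasoning
        a b s : ℕ
        a = ∣ S ∩ N G v ∣
        b = ∣ ∁ S ∩ N G v ∣
        s = dev (N G v) S
        b≤ : b ≤ a + s
        b≤ = m≤n+∣n-m∣ b a
        collect : ∀ n d → 2 * n + 2 * (d * n) ≡ 2 * (d + 1) * n
        collect = solve-∀
        expand : ∀ q n → 2 * (4 * q) * n ≡ 8 * q * n
        expand = solve-∀
        arrange : ∀ q a s → 8 * q * ((a + (a + s)) + (a + (a + s))) ≡ 2 * (8 * q * s) + 2 * (16 * q * a)
        arrange = solve-∀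

      dev-S : ∀ S → 8 * Q * ∣ S ∣ ≤ D * n → n ≤ 8 * Q * dev ⊤ S
      -- The deviation is even at least `n/(4Q)`; half is given away to share the bound of `dev-N`.
      dev-S S small = ≤-trans (m≤n+m n n) (+-cancelʳ-≤ (2 * (D * n)) _ _ (begin
        n + n + 2 * (D * n)
          ≡⟨ trans (collect n D) (trans (cong (λ k → 2 * k * n) D+1≡4Q) (expand Q n)) ⟩
        8 * Q * n
          ≤⟨ *-monoʳ-≤ (8 * Q) (proj₁ (dev-⊤ S)) ⟩
        8 * Q * (∣ S ∣ + ∣ S ∣ + dev ⊤ S)
          ≡⟨ arrange Q ∣ S ∣ (dev ⊤ S) ⟩
        8 * Q * dev ⊤ S + 2 * (8 * Q * ∣ S ∣)
          ≤⟨ +-monoʳ-≤ (8 * Q * dev ⊤ S) (*-monoʳ-≤ 2 small) ⟩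
        8 * Q * dev ⊤ S + 2 * (D * n) ∎))
        where
        open ≤-Reasoning
        collect : ∀ n d → n + n + 2 * (d * n) ≡ 2 * (d + 1) * n
        collect = solve-∀
        expand : ∀ q n → 2 * (4 * q) * n ≡ 8 * q * n
        expand = solve-∀
        arrange : ∀ q m s → 8 * q * (m + m + s) ≡ 8 * q * s + 2 * (8 * q * m)
        arrange = solve-∀

      -- With `n ≥ 8` the size exceeds `D / Q`, and `D = 4q + 3` is at least `3Q`.
      big⇒3≤ : ∀ (S : Subset n) → D * n < 8 * Q * ∣ S ∣ → 3 ≤ ∣ S ∣
      big⇒3≤ S big = *-cancelˡ-≤ (8 * Q) (begin
        8 * Q * 3              ≤⟨ m≤m+n (8 * Q * 3) (8 * q) ⟩
        8 * Q * 3 + 8 * q      ≡⟨ arrange q ⟩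
        D * 8                  ≤⟨ *-monoʳ-≤ D 8≤n ⟩
        D * n                  ≤⟨ <⇒≤ big ⟩
        8 * Q * ∣ S ∣          ∎)
        where
        open ≤-Reasoning
        arrange : ∀ q → 8 * suc q * 3 + 8 * q ≡ (4 * q + 3) * 8
        arrange = solve-∀

      deviates : ∀ S s → s ⁴ ≤ deviation S → n ≤ 8 * Q * s → D * n * n ⁴ ≤
        D * n * n ⁴ * 𝟙-cyclic G S + (16 * Q * n ⁴ * poor-count G S + D * n * (8 * Q) ⁴ * deviation S)
      deviates S s s≤ n≤ = begin
        D * n * n ⁴                          ≤⟨ *-monoʳ-≤ (D * n) (m⁴-mono n≤) ⟩
        D * n * (8 * Q * s) ⁴                ≡⟨ cong (D * n *_) (⁴-* (8 * Q) s) ⟩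
        D * n * ((8 * Q) ⁴ * s ⁴)            ≡⟨ *-assoc (D * n) ((8 * Q) ⁴) (s ⁴) ⟨
        D * n * (8 * Q) ⁴ * s ⁴              ≤⟨ *-monoʳ-≤ (D * n * (8 * Q) ⁴) s≤ ⟩
        D * n * (8 * Q) ⁴ * deviation S      ≤⟨ m≤n+m _ (16 * Q * n ⁴ * poor-count G S) ⟩
        16 * Q * n ⁴ * poor-count G S + D * n * (8 * Q) ⁴ * deviation S
                                             ≤⟨ m≤n+m _ (D * n * n ⁴ * 𝟙-cyclic G S) ⟩
        D * n * n ⁴ * 𝟙-cyclic G S + (16 * Q * n ⁴ * poor-count G S + D * n * (8 * Q) ⁴ * deviation S) ∎
        where open ≤-Reasoning

      -- Two Markov inequalities in one pointwise bound. After division by `D n n⁴`, the three terms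
      -- are the indicator of cyclicity, the number of poor vertices over its cutoff, and the scaled
      -- deviation; in every case one of them is at least 1.
      dichotomy : ∀ S → D * n * n ⁴ ≤
        D * n * n ⁴ * 𝟙-cyclic G S + (16 * Q * n ⁴ * poor-count G S + D * n * (8 * Q) ⁴ * deviation S)
      dichotomy S with 16 * Q * poor-count G S ≤? D * n | 8 * Q * ∣ S ∣ ≤? D * n
        | any? (λ v → 16 * Q * ∣ S ∩ N G v ∣ ≤? D * n)
      ... | no many | _ | _ = begin
        D * n * n ⁴                          ≤⟨ *-monoˡ-≤ (n ⁴) (<⇒≤ (≰⇒> many)) ⟩
        16 * Q * poor-count G S * n ⁴        ≡⟨ swap (16 * Q) (poor-count G S) (n ⁴) ⟩
        16 * Q * n ⁴ * poor-count G S        ≤⟨ m≤m+n _ (D * n * (8 * Q) ⁴ * deviation S) ⟩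
        16 * Q * n ⁴ * poor-count G S + D * n * (8 * Q) ⁴ * deviation S
                                             ≤⟨ m≤n+m _ (D * n * n ⁴ * 𝟙-cyclic G S) ⟩
        D * n * n ⁴ * 𝟙-cyclic G S + (16 * Q * n ⁴ * poor-count G S + D * n * (8 * Q) ⁴ * deviation S) ∎
        where
        open ≤-Reasoning
        swap : ∀ a b c → a * b * c ≡ a * c * b
        swap = solve-∀
      ... | yes _ | yes small | _ = deviates S (dev ⊤ S) (m≤m+n (dev ⊤ S ⁴) _) (dev-S S small)
      ... | yes _ | no _ | yes (v , small) =
        deviates S (dev (N G v) S) (≤-trans (∑-term (λ v → dev (N G v) S ⁴) v) (m≤n+m _ (dev ⊤ S ⁴))) (dev-N S v small)
      ... | yes few | no big | no typical = begin
        D * n * n ⁴                       ≡⟨ *-identityʳ _ ⟨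
        D * n * n ⁴ * 1                   ≡⟨ cong (λ b → D * n * n ⁴ * 𝟙 b) (sym (dec-true (cyclic? G S) cyclic)) ⟩
        D * n * n ⁴ * 𝟙-cyclic G S
          ≤⟨ m≤m+n _ (16 * Q * n ⁴ * poor-count G S + D * n * (8 * Q) ⁴ * deviation S) ⟩
        D * n * n ⁴ * 𝟙-cyclic G S + (16 * Q * n ⁴ * poor-count G S + D * n * (8 * Q) ⁴ * deviation S) ∎
        where
        open ≤-Reasoning
        cyclic : Cyclic G S
        cyclic = cyclic-criterion G S (big⇒3≤ S (≰⇒> big))
          (*-cancelˡ-≤ (8 * Q) (≤-trans (≤-reflexive (assoc Q (poor-count G S))) (≤-trans few (<⇒≤ (≰⇒> big)))))
          (λ v → *-cancelˡ-< (16 * Q) _ _ (≤-<-trans few (≰⇒> (λ small → typical (v , small)))))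
          where
          assoc : ∀ q b → 8 * q * (2 * b) ≡ 16 * q * b
          assoc = solve-∀

    -- The mean number of poor vertices is at most `(D - 1)/D` of the cutoff, which leaves a
    -- proportion `1/D` of the sets; the deviations take at most half of that.
    many-cyclic : ∀ {h l} → 8 ≤ n → 6 * D * (8 * Q) ⁴ * suc n ≤ n * n →
      n < h + h → n ≤ (Q * l) * (Q * l) → NonZero l → (∀ v → l + h ≤ degree G v) →
      2 ^ n ≤ 2 * D * Cyc G
    many-cyclic {h} {l} 8≤n large n<2h n≤r² l≢0 deg = *-cancelʳ-≤ P (2 * D * C) (n * n ⁴) {{n⁵≢0}}
      (+-cancelˡ-≤ (n * n ⁴ * P) _ _ final)
      where
      open ≤-Reasoning
      P C V W : ℕ
      P = 2 ^ n
      C = Cyc G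
      V = ∑ (subsets n) (poor-count G)
      W = ∑ (subsets n) deviation

      n≢0 : NonZero n
      n≢0 = >-nonZero (≤-trans (s≤s z≤n) 8≤n)
      n⁵≢0 : NonZero (n * n ⁴)
      n⁵≢0 = m*n≢0 n (n ⁴) {{n≢0}} {{m*n≢0 (n * n) (n * n) {{m*n≢0 n n {{n≢0}} {{n≢0}}}} {{m*n≢0 n n {{n≢0}} {{n≢0}}}}}}

      summed : P * (D * n * n ⁴) ≤ D * n * n ⁴ * C + (16 * Q * n ⁴ * V + D * n * (8 * Q) ⁴ * W)
      summed = begin
        P * (D * n * n ⁴)
          ≡⟨ ∑-subsets-const n (D * n * n ⁴) ⟨
        ∑ (subsets n) (λ _ → D * n * n ⁴)
          ≤⟨ ∑-mono (subsets n) (dichotomy 8≤n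
               (λ v → ≤-trans (<⇒≤ n<2h) (+-mono-≤ (≤-trans (m≤n+m h l) (deg v)) (≤-trans (m≤n+m h l) (deg v))))) ⟩
        _
          ≡⟨ trans (∑-+ _ _ (subsets n)) (cong₂ _+_ (∑-*ˡ (D * n * n ⁴) (𝟙-cyclic G) (subsets n))
               (trans (∑-+ _ _ (subsets n)) (cong₂ _+_ (∑-*ˡ (16 * Q * n ⁴) (poor-count G) (subsets n))
                 (∑-*ˡ (D * n * (8 * Q) ⁴) deviation (subsets n))))) ⟩
        D * n * n ⁴ * ∑ (subsets n) (𝟙-cyclic G) + (16 * Q * n ⁴ * V + D * n * (8 * Q) ⁴ * W)
          ≡⟨ cong (λ c → D * n * n ⁴ * c + (16 * Q * n ⁴ * V + D * n * (8 * Q) ⁴ * W)) (Cyc≡∑ G) ⟨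
        D * n * n ⁴ * C + (16 * Q * n ⁴ * V + D * n * (8 * Q) ⁴ * W) ∎

      -- The gap `1/(4Q)` of `tail-near-half`, halved by the condition that the vertex lies in `S`,
      -- becomes `2n/(16Q)`. One `n` of it goes into `D = 4Q - 1`, the other remains on the left.
      poor : 16 * Q * V + n * P ≤ D * n * P
      poor = +-cancelʳ-≤ (n * P) _ _ (begin
        16 * Q * V + n * P + n * P            ≡⟨ arrange Q V n P ⟩
        8 * Q * (2 * V) + 2 * n * P           ≤⟨ +-monoˡ-≤ (2 * n * P) (*-monoʳ-≤ (8 * Q) (∑-poor G deg)) ⟩
        8 * Q * (n * tail n (l + h)) + 2 * n * P ≡⟨ arrange′ Q n (tail n (l + h)) P ⟩
        2 * n * (4 * Q * tail n (l + h) + P)  ≤⟨ *-monoʳ-≤ (2 * n) (tail-near-half q n<2h n≤r² l≢0) ⟩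
        2 * n * (2 * Q * P)                   ≡⟨ collect q n P ⟩
        D * n * P + n * P                     ∎)
        where
        arrange : ∀ q b n p → 16 * q * b + n * p + n * p ≡ 8 * q * (2 * b) + 2 * n * p
        arrange = solve-∀
        arrange′ : ∀ q n t p → 8 * q * (n * t) + 2 * n * p ≡ 2 * n * (4 * q * t + p)
        arrange′ = solve-∀
        collect : ∀ q n p → 2 * n * (2 * suc q * p) ≡ (4 * q + 3) * n * p + n * p
        collect = solve-∀

      -- The hypothesis `large` is the condition that makes this share at most `1/(2D)`.
      deviations : 2 * (D * n * (8 * Q) ⁴ * W) ≤ n * n ⁴ * P
      deviations = begin
        2 * (D * n * (8 * Q) ⁴ * W)
          ≤⟨ *-monoʳ-≤ 2 (*-monoʳ-≤ (D * n * (8 * Q) ⁴) ∑-deviation) ⟩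
        2 * (D * n * (8 * Q) ⁴ * (suc n * (3 * n ² * P)))
          ≡⟨ arrange D n ((8 * Q) ⁴) (suc n) P ⟩
        6 * D * (8 * Q) ⁴ * suc n * (n * n ² * P)
          ≤⟨ *-monoˡ-≤ (n * n ² * P) large ⟩
        n * n * (n * n ² * P)
          ≡⟨ collect n P ⟩
        n * n ⁴ * P ∎
        where
        arrange : ∀ d n r m p → 2 * (d * n * r * (m * (3 * (n * n) * p))) ≡ 6 * d * r * m * (n * (n * n) * p)
        arrange = solve-∀
        collect : ∀ n p → n * n * (n * (n * n) * p) ≡ n * ((n * n) * (n * n)) * p
        collect = solve-∀

      final : n * n ⁴ * P + P * (n * n ⁴) ≤ n * n ⁴ * P + 2 * D * C * (n * n ⁴)
      final = +-cancelʳ-≤ (2 * (D * n * n ⁴ * P)) _ _ (begin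
        n * n ⁴ * P + P * (n * n ⁴) + 2 * (D * n * n ⁴ * P)
          ≡⟨ e₁ (n ⁴) n P D ⟩
        2 * (P * (D * n * n ⁴)) + 2 * n ⁴ * (n * P)
          ≤⟨ +-monoˡ-≤ _ (*-monoʳ-≤ 2 summed) ⟩
        2 * (D * n * n ⁴ * C + (16 * Q * n ⁴ * V + D * n * (8 * Q) ⁴ * W)) + 2 * n ⁴ * (n * P)
          ≡⟨ e₂ (D * n * n ⁴ * C) Q (n ⁴) V (D * n * (8 * Q) ⁴ * W) (n * P) ⟩
        2 * (D * n * n ⁴ * C) + 2 * n ⁴ * (16 * Q * V + n * P) + 2 * (D * n * (8 * Q) ⁴ * W)
          ≤⟨ +-mono-≤ (+-monoʳ-≤ (2 * (D * n * n ⁴ * C)) (*-monoʳ-≤ (2 * n ⁴) poor)) deviations ⟩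
        2 * (D * n * n ⁴ * C) + 2 * n ⁴ * (D * n * P) + n * n ⁴ * P
          ≡⟨ e₃ D n (n ⁴) C P ⟩
        n * n ⁴ * P + 2 * D * C * (n * n ⁴) + 2 * (D * n * n ⁴ * P) ∎)
        where
        e₁ : ∀ f n p d → n * f * p + p * (n * f) + 2 * (d * n * f * p) ≡ 2 * (p * (d * n * f)) + 2 * f * (n * p)
        e₁ = solve-∀
        e₂ : ∀ x q f b w y → 2 * (x + (16 * q * f * b + w)) + 2 * f * y ≡ 2 * x + 2 * f * (16 * q * b + y) + 2 * w
        e₂ = solve-∀
        e₃ : ∀ d n f c p → 2 * (d * n * f * c) + 2 * f * (d * n * p) + n * f * p ≡
          n * f * p + 2 * d * c * (n * f) + 2 * (d * n * f * p)
        e₃ = solve-∀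

  -- Integer thresholds from the degree condition

  quotient-bounds : ∀ m Q .{{_ : NonZero Q}} → m < Q * suc (m / Q) × Q * suc (m / Q) ≤ m + Q
  quotient-bounds m Q = lower , upper
    where
    open ≤-Reasoning
    split : m ≡ m % Q + m / Q * Q
    split = m≡m%n+[m/n]*n m Q
    expand : ∀ Q x → Q + x * Q ≡ Q * suc x
    expand = solve-∀
    lower : m < Q * suc (m / Q)
    lower = begin-strict
      m                        ≡⟨ split ⟩
      m % Q + m / Q * Q        <⟨ +-monoˡ-< (m / Q * Q) (m%n<n m Q) ⟩
      Q + m / Q * Q            ≡⟨ expand Q (m / Q) ⟩
      Q * suc (m / Q)          ∎
    upper : Q * suc (m / Q) ≤ m + Q
    upper = begin
      Q * suc (m / Q)          ≡⟨ expand Q (m / Q) ⟨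
      Q + m / Q * Q            ≤⟨ +-monoʳ-≤ Q (m≤n+m (m / Q * Q) (m % Q)) ⟩
      Q + (m % Q + m / Q * Q)  ≡⟨ cong (Q +_) split ⟨
      Q + m                    ≡⟨ +-comm Q m ⟩
      m + Q                    ∎

  -- Divided by `Q = 2(k + 1)`, the hypothesis on `d` reads `n/2 + 2s/Q ≤ d + 1`. One `s/Q` provides
  -- `l`, so that `Q` steps of length `l` cover `√n`. The other absorbs three units: the rounding of
  -- `h`, that of `l`, and the one added to `d`.
  thresholds : ∀ k n s → let Q = suc (suc (2 * k)) in n < suc s * suc s → 3 * Q ≤ s →
    ∃ λ h → ∃ λ l → n < h + h × n ≤ (Q * l) * (Q * l) × NonZero l ×
      (∀ d → suc k * n + 2 * s ≤ Q * suc d → l + h ≤ d)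
  thresholds k n s n<s⁺² 3Q≤s with quotient-bounds n 2 | quotient-bounds s (suc (suc (2 * k)))
  ... | n<2h , 2h≤ | s<Ql , Ql≤ = h , l
    , ≤-trans n<2h (≤-reflexive (double h))
    , ≤-trans (<⇒≤ n<s⁺²) (*-mono-≤ s<Ql s<Ql)
    , _
    , λ d deg → *-cancelˡ-≤ Q (+-cancelʳ-≤ Q _ _ (begin
        Q * (l + h) + Q
          ≡⟨ e₁ k l h ⟩
        Q * l + (suc k * (2 * h) + Q)
          ≤⟨ +-mono-≤ Ql≤ (+-monoˡ-≤ Q (*-monoʳ-≤ (suc k) 2h≤)) ⟩
        s + Q + (suc k * (n + 2) + Q)
          ≡⟨ e₂ k s n ⟩
        suc k * n + (s + 3 * Q)
          ≤⟨ +-monoʳ-≤ (suc k * n) (+-monoʳ-≤ s 3Q≤s) ⟩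
        suc k * n + (s + s)
          ≡⟨ cong (suc k * n +_) (sym (double s)) ⟩
        suc k * n + 2 * s
          ≤⟨ deg ⟩
        Q * suc d
          ≡⟨ e₃ Q d ⟩
        Q * d + Q ∎))
    where
    open ≤-Reasoning
    Q h l : ℕ
    Q = suc (suc (2 * k))
    h = suc (n / 2)
    l = suc (s / Q)
    double : ∀ h → 2 * h ≡ h + h
    double = solve-∀
    e₁ : ∀ k l h → (suc (suc (2 * k))) * (l + h) + suc (suc (2 * k)) ≡
      (suc (suc (2 * k))) * l + (suc k * (2 * h) + suc (suc (2 * k)))
    e₁ = solve-∀
    e₂ : ∀ k s n → s + suc (suc (2 * k)) + (suc k * (n + 2) + suc (suc (2 * k))) ≡
      suc k * n + (s + 3 * suc (suc (2 * k)))
    e₂ = solve-∀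
    e₃ : ∀ Q d → Q * suc d ≡ Q * d + Q
    e₃ = solve-∀

  largeness : ∀ c n → 2 * c ≤ n → NonZero n → c * suc n ≤ n * n
  largeness c (suc n) 2c≤n _ = begin
    c * suc (suc n)      ≤⟨ m≤m+n _ (c * n) ⟩
    c * suc (suc n) + c * n ≡⟨ arrange c n ⟩
    2 * c * suc n        ≤⟨ *-monoˡ-≤ (suc n) 2c≤n ⟩
    suc n * suc n        ∎
    where
    open ≤-Reasoning
    arrange : ∀ c n → c * suc (suc n) + c * n ≡ 2 * c * suc n
    arrange = solve-∀

  square-reflects-≤ : ∀ {a s n} → n < suc s * suc s → a * a ≤ n → a ≤ s
  square-reflects-≤ {a} {s} n<s⁺² a²≤n = ≮⇒≥ λ s<a →
    <⇒≱ n<s⁺² (≤-trans (*-mono-≤ s<a s<a) a²≤n)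

open Discrete using (_⁴; many-cyclic; thresholds; largeness; square-reflects-≤)
open import Defs
open import Data.Integer.Base as ℤ using (+_)
open import Data.Rational.Base as ℚ using (0ℚ; 1ℚ; _/_)

-- From the reals to the naturals

minDegree≤degree : ∀ {n} (G : Graph n) v → minDegree G ℕ.≤ degree G v
minDegree≤degree {n} G v = All.lookup (min≤xs n (map (degree G) (allFin n))) (∈-map⁺ (degree G) (∈-allFin v))

pos-* : ∀ a b → + a ℤ.* + b ≡ + (a ℕ.* b)
pos-* a b = sym (ℤ.pos-* a b)

-- Multiplication by `2(k + 1)`. The `1ℚ` is the tolerance in the order of the reals and becomes the
-- `suc` on `d`.
clear-denominators : ∀ n k s d →
  (+ n / 2) ℚ.+ (+ 1 / suc k) ℚ.* (+ s / 1) ℚ.≤ (+ d / 1) ℚ.+ 1ℚ →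
  suc k ℕ.* n ℕ.+ 2 ℕ.* s ℕ.≤ suc (suc (2 ℕ.* k)) ℕ.* suc d
clear-denominators n k s d le = subst₂ ℕ._≤_ (lhs n k s) (rhs d k)
  (ℤ.drop‿+≤+ (subst₂ ℤ._≤_ left right (ℚᵘ.drop-*≤* unnormalised)))
  where
  open ℚᵘ.≤-Reasoning
  unnormalised : mkℚᵘ (+ n) 1 ℚᵘ.+ mkℚᵘ (+ 1) k ℚᵘ.* mkℚᵘ (+ s) 0 ℚᵘ.≤ mkℚᵘ (+ d) 0 ℚᵘ.+ mkℚᵘ (+ 1) 0
  unnormalised = begin
    mkℚᵘ (+ n) 1 ℚᵘ.+ mkℚᵘ (+ 1) k ℚᵘ.* mkℚᵘ (+ s) 0
      ≃⟨ ℚᵘ.+-cong (ℚ.toℚᵘ-fromℚᵘ (mkℚᵘ (+ n) 1))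
           (ℚᵘ.≃-trans (ℚ.toℚᵘ-homo-* (+ 1 / suc k) (+ s / 1))
             (ℚᵘ.*-cong (ℚ.toℚᵘ-fromℚᵘ (mkℚᵘ (+ 1) k)) (ℚ.toℚᵘ-fromℚᵘ (mkℚᵘ (+ s) 0)))) ⟨
    ℚ.toℚᵘ (+ n / 2) ℚᵘ.+ ℚ.toℚᵘ ((+ 1 / suc k) ℚ.* (+ s / 1))
      ≃⟨ ℚ.toℚᵘ-homo-+ (+ n / 2) ((+ 1 / suc k) ℚ.* (+ s / 1)) ⟨
    ℚ.toℚᵘ ((+ n / 2) ℚ.+ (+ 1 / suc k) ℚ.* (+ s / 1))
      ≤⟨ ℚ.toℚᵘ-mono-≤ le ⟩
    ℚ.toℚᵘ ((+ d / 1) ℚ.+ 1ℚ)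
      ≃⟨ ℚ.toℚᵘ-homo-+ (+ d / 1) 1ℚ ⟩
    ℚ.toℚᵘ (+ d / 1) ℚᵘ.+ mkℚᵘ (+ 1) 0
      ≃⟨ ℚᵘ.+-cong (ℚ.toℚᵘ-fromℚᵘ (mkℚᵘ (+ d) 0)) ℚᵘ.≃-refl ⟩
    mkℚᵘ (+ d) 0 ℚᵘ.+ mkℚᵘ (+ 1) 0 ∎
  K : ℕ
  K = suc (k ℕ.* 1)
  left : (+ n ℤ.* + K ℤ.+ (+ 1 ℤ.* + s) ℤ.* + 2) ℤ.* + 1 ≡ + ((n ℕ.* K ℕ.+ 1 ℕ.* s ℕ.* 2) ℕ.* 1)
  left = trans (cong (ℤ._* + 1) (cong₂ ℤ._+_ (pos-* n K)
    (trans (cong (ℤ._* + 2) (pos-* 1 s)) (pos-* (1 ℕ.* s) 2)))) (pos-* (n ℕ.* K ℕ.+ 1 ℕ.* s ℕ.* 2) 1)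
  right : (+ d ℤ.* + 1 ℤ.+ + 1 ℤ.* + 1) ℤ.* + (2 ℕ.* K) ≡ + ((d ℕ.* 1 ℕ.+ 1) ℕ.* (2 ℕ.* K))
  right = trans (cong (λ x → (x ℤ.+ + 1) ℤ.* + (2 ℕ.* K)) (pos-* d 1)) (pos-* (d ℕ.* 1 ℕ.+ 1) (2 ℕ.* K))
  lhs : ∀ n k s → (n ℕ.* suc (k ℕ.* 1) ℕ.+ 1 ℕ.* s ℕ.* 2) ℕ.* 1 ≡ suc k ℕ.* n ℕ.+ 2 ℕ.* s
  lhs = solve-∀
  rhs : ∀ d k → (d ℕ.* 1 ℕ.+ 1) ℕ.* (2 ℕ.* suc (k ℕ.* 1)) ≡ suc (suc (2 ℕ.* k)) ℕ.* suc d
  rhs = solve-∀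

scaled-≤ : ∀ w p m → p ℕ.≤ suc w ℕ.* m → (+ 1 / suc w) ℚ.* (+ p / 1) ℚ.≤ (+ m / 1)
scaled-≤ w p m le = ℚ.toℚᵘ-cancel-≤ (begin
  ℚ.toℚᵘ ((+ 1 / suc w) ℚ.* (+ p / 1))
    ≃⟨ ℚᵘ.≃-trans (ℚ.toℚᵘ-homo-* (+ 1 / suc w) (+ p / 1))
         (ℚᵘ.*-cong (ℚ.toℚᵘ-fromℚᵘ (mkℚᵘ (+ 1) w)) (ℚ.toℚᵘ-fromℚᵘ (mkℚᵘ (+ p) 0))) ⟩
  mkℚᵘ (+ 1) w ℚᵘ.* mkℚᵘ (+ p) 0
    ≤⟨ ℚᵘ.*≤* (subst₂ ℤ._≤_ (sym left) (sym right) (ℤ.+≤+ (subst₂ ℕ._≤_ (lhs p) (rhs w m) le))) ⟩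
  mkℚᵘ (+ m) 0
    ≃⟨ ℚ.toℚᵘ-fromℚᵘ (mkℚᵘ (+ m) 0) ⟨
  ℚ.toℚᵘ (+ m / 1) ∎)
  where
  open ℚᵘ.≤-Reasoning
  left : (+ 1 ℤ.* + p) ℤ.* + 1 ≡ + (1 ℕ.* p ℕ.* 1)
  left = trans (cong (ℤ._* + 1) (pos-* 1 p)) (pos-* (1 ℕ.* p) 1)
  right : + m ℤ.* + suc (w ℕ.* 1) ≡ + (m ℕ.* suc (w ℕ.* 1))
  right = pos-* m (suc (w ℕ.* 1))
  lhs : ∀ p → p ≡ 1 ℕ.* p ℕ.* 1
  lhs = solve-∀
  rhs : ∀ w m → suc w ℕ.* m ≡ m ℕ.* suc (w ℕ.* 1)
  rhs = solve-∀

p≤p+ε : ∀ p {ε} → 0ℚ ℚ.< ε → p ℚ.≤ p ℚ.+ ε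
p≤p+ε p {ε} 0<ε = subst (ℚ._≤ p ℚ.+ ε) (ℚ.+-identityʳ p) (ℚ.+-monoʳ-≤ p (ℚ.<⇒≤ 0<ε))

1/suc-pos : ∀ w → 0ℚ ℚ.< (+ 1 / suc w)
1/suc-pos w = ℚ.positive⁻¹ (+ 1 / suc w) {{ℚ.normalize-pos 1 (suc w)}}

⌊√⌋ : ℕ → ℕ
⌊√⌋ n = √-numerator n 0

n<⌊√⌋+1² : ∀ n → n ℕ.< suc (⌊√⌋ n) ℕ.* suc (⌊√⌋ n)
n<⌊√⌋+1² n = subst (ℕ._< suc (⌊√⌋ n) ℕ.* suc (⌊√⌋ n)) (ℕ.*-identityʳ n) (proj₂ (proj₂ (floorSqrt (n ℕ.* 1))))

⌊√⌋≤√-seq : ∀ n i → (+ ⌊√⌋ n / 1) ℚ.≤ √-seq n i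
⌊√⌋≤√-seq n i = √-Lemmas./-mono (⌊√⌋ n) (√-numerator n i) 0 i
  (subst (⌊√⌋ n ℕ.* suc i ℕ.≤_) (sym (ℕ.*-identityʳ (√-numerator n i)))
    (ℕ.s≤s⁻¹ (subst (⌊√⌋ n ℕ.* suc i ℕ.<_) (ℕ.*-identityʳ (suc (√-numerator n i))) (√-Lemmas.cross n 0 i))))

positive⇒1/suc : ∀ c → 0ℝ < c → ∃ λ k → ∃ λ M → ∀ i → M ℕ.≤ i → (+ 1 / suc k) ℚ.≤ seq c i
positive⇒1/suc c (ε , 0<ε , M , ε≤c) with √-Lemmas.archimedean ε 0<ε
... | k , 1/≤ε = k , M , λ i M≤i →
  ℚ.≤-trans (1/≤ε k ℕ.≤-refl) (subst (ℚ._≤ seq c i) (ℚ.+-identityˡ ε) (ε≤c i M≤i))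

-- The inequality of reals is read off with tolerance 1, at an index late enough for it and for the
-- lower bound on `c`. A constant loss is harmless beside the term of order `√n`.
degree-bound : ∀ (c : ℝ) k M → (∀ i → M ℕ.≤ i → (+ 1 / suc k) ℚ.≤ seq c i) → ∀ n d →
  fromℚ (+ n / 2) + c * √ n ≤ fromℕ d → suc k ℕ.* n ℕ.+ 2 ℕ.* ⌊√⌋ n ℕ.≤ suc (suc (2 ℕ.* k)) ℕ.* suc d
degree-bound c k M 1/≤c n d le with le 1ℚ (ℚ.positive⁻¹ 1ℚ)
... | L , le-at = clear-denominators n k (⌊√⌋ n) d (ℚ.≤-trans
    (ℚ.+-monoʳ-≤ (+ n / 2) (Lemmas.*-mono {+ 1 / suc k} {+ ⌊√⌋ n / 1} {seq c i} {√-seq n i}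
      (ℚ.nonNegative⁻¹ (+ ⌊√⌋ n / 1) {{ℚ.normalize-nonNeg (⌊√⌋ n) 1}})
      (ℚ.≤-trans (ℚ.<⇒≤ (1/suc-pos k)) (1/≤c i (ℕ.m≤m⊔n M L)))
      (1/≤c i (ℕ.m≤m⊔n M L)) (⌊√⌋≤√-seq n i)))
    (le-at i (ℕ.m≤n⊔m M L)))
  where
  i = M ⊔ L

-- One less than `2D` in `many-cyclic`, where `D = 4q + 3` and `q = 2k + 1`.
denominator-1 : ℕ → ℕ
denominator-1 k = 8 ℕ.* suc (2 ℕ.* k) ℕ.+ 5

-- Opaque, so that the large bounds it is applied to are not unfolded.
abstract
  eventually₃ : ∀ a b c → ∃ λ n₀ → ∀ n → n₀ ℕ.≤ n → a ℕ.≤ n × b ℕ.≤ n × c ℕ.≤ n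
  eventually₃ a b c = a ⊔ (b ⊔ c) , λ n le →
      ℕ.m⊔n≤o⇒m≤o a (b ⊔ c) le
    , ℕ.m⊔n≤o⇒m≤o b c (ℕ.m⊔n≤o⇒n≤o a (b ⊔ c) le)
    , ℕ.m⊔n≤o⇒n≤o b c (ℕ.m⊔n≤o⇒n≤o a (b ⊔ c) le)

cyclic-fraction : ∀ k → ∃ λ n₀ → ∀ n → n₀ ℕ.≤ n → ∀ s → n ℕ.< suc s ℕ.* suc s → (G : Graph n) →
  (∀ v → suc k ℕ.* n ℕ.+ 2 ℕ.* s ℕ.≤ suc (suc (2 ℕ.* k)) ℕ.* suc (degree G v)) →
  2 ℕ.^ n ℕ.≤ suc (denominator-1 k) ℕ.* Cyc G
cyclic-fraction k = proj₁ large , λ n n₀≤n → from-bounds n (proj₂ large n n₀≤n)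
  where
  q Q R : ℕ
  q = suc (2 ℕ.* k)
  Q = suc q
  R = 6 ℕ.* (4 ℕ.* q ℕ.+ 3) ℕ.* (8 ℕ.* Q) ⁴
  -- The bounds give, in this order, at least three vertices in `S`, the inequality `3Q ≤ s` that
  -- absorbs rounding, and a small share of deviating sets.
  large = eventually₃ 8 ((3 ℕ.* Q) ℕ.* (3 ℕ.* Q)) (2 ℕ.* R)
  2D≡ : ∀ q → 2 ℕ.* (4 ℕ.* q ℕ.+ 3) ≡ suc (8 ℕ.* q ℕ.+ 5)
  2D≡ = solve-∀
  from-bounds : ∀ n → 8 ℕ.≤ n × (3 ℕ.* Q) ℕ.* (3 ℕ.* Q) ℕ.≤ n × 2 ℕ.* R ℕ.≤ n →
    ∀ s → n ℕ.< suc s ℕ.* suc s → (G : Graph n) →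
    (∀ v → suc k ℕ.* n ℕ.+ 2 ℕ.* s ℕ.≤ Q ℕ.* suc (degree G v)) →
    2 ℕ.^ n ℕ.≤ suc (denominator-1 k) ℕ.* Cyc G
  from-bounds n (8≤n , 9Q²≤n , 2R≤n) s n<s⁺² G degrees =
    subst (λ x → 2 ℕ.^ n ℕ.≤ x ℕ.* Cyc G) (2D≡ q)
      (conclude (thresholds k n s n<s⁺² (square-reflects-≤ n<s⁺² 9Q²≤n)))
    where
    conclude : (∃ λ h → ∃ λ l → n ℕ.< h ℕ.+ h × n ℕ.≤ (Q ℕ.* l) ℕ.* (Q ℕ.* l) × ℕ.NonZero l ×
        (∀ d → suc k ℕ.* n ℕ.+ 2 ℕ.* s ℕ.≤ Q ℕ.* suc d → l ℕ.+ h ℕ.≤ d)) →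
      2 ℕ.^ n ℕ.≤ 2 ℕ.* (4 ℕ.* q ℕ.+ 3) ℕ.* Cyc G
    conclude (h , l , n<2h , n≤r² , l≢0 , far) = many-cyclic G q 8≤n
      (largeness R n 2R≤n (ℕ.>-nonZero (ℕ.≤-trans (s≤s z≤n) 8≤n)))
      n<2h n≤r² l≢0 (λ v → far (degree G v) (degrees v))

proposition1p3 : ∀ (c : ℝ) → 0ℝ < c →
    ∃ λ (c′ : ℝ) → 0ℝ < c′ × ∃ λ (n₀ : ℕ) →
    ∀ (n : ℕ) → n₀ ℕ.≤ n → (G : Graph n) →
    fromℚ (+ n / 2) + c * √ n ≤ fromℕ (minDegree G) →
    c′ * fromℕ (2 ℕ.^ n) ≤ fromℕ (Cyc G)
proposition1p3 c 0<c =
  let k , M , 1/≤c = positive⇒1/suc c 0<c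
      w            = denominator-1 k
  in fromℚ (+ 1 / suc w)
    , (+ 1 / suc w , 1/suc-pos w , 0 , λ _ _ → ℚ.≤-reflexive (ℚ.+-identityˡ (+ 1 / suc w)))
    -- Both sides of the conclusion are constant sequences, so index 0 serves every `ε`.
    , proj₁ (cyclic-fraction k) , λ n n₀≤n G le ε 0<ε → 0 , λ _ _ → ℚ.≤-trans
        (scaled-≤ w (2 ℕ.^ n) (Cyc G) (proj₂ (cyclic-fraction k) n n₀≤n (⌊√⌋ n) (n<⌊√⌋+1² n) G
          (λ v → ℕ.≤-trans (degree-bound c k M 1/≤c n (minDegree G) le)
            (ℕ.*-monoʳ-≤ (suc (suc (2 ℕ.* k))) (s≤s (minDegree≤degree G v))))))
        (p≤p+ε (+ Cyc G / 1) 0<ε)
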